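{- There are no normalized lonely trees with an even number of vertices, and for every integer $k\ge 0$ there are precisely $A_{k+1}$ normalized lonely trees on $2k+1$ vertices, where $(A_m)_{m\ge1}$ is Lassalle's sequence.
   Context: Lassalle's sequence $(A_m)_{m\geq 1}$ is defined by $A_1=1$ and $A_m=(-1)^{m-1}C_m+\sum_{j=1}^{m-1}(-1)^{j-1}\binom{2m-1}{2m-2j-1}A_{m-j}C_j$, where $C_n=\frac{1}{n+1}\binom{2n}{n}$. A decreasing binary plane tree is a (nonempty) rooted plane tree whose vertices are labeled with distinct positive integers, in which every non-root vertex has a smaller label than its parent and every vertex has at most two children; if a vertex has exactly one child, one distinguishes whether it is a left or a right child. Such a tree is normalized if its set of labels is $\{1,\ldots,n\}$ for some $n$. The postorder $P(T)$ of a decreasing binary plane tree $T$ is the word of labels obtained by reading first the left subtree of the root, then the right subtree of the root, each recursively in postorder, and finally the root. A decreasing binary plane tree $T$ is lonely if no other decreasing binary plane tree has the same postorder as $T$. -}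

module Defs where

import Algebra.Properties.Monoid.Sum
open import Data.Fin.Base using (Fin; zero; suc; toℕ)
open import Data.Integer.Base as ℤ using (ℤ; +_; -1ℤ; 0ℤ)
import Data.Integer.Properties as ℤ
open import Data.List.Base using (List; []; _∷_; [_]; _++_; length)
open import Data.List.Membership.Propositional using (_∈_)
open import Data.List.Properties using (++-assoc)
open import Data.List.Relation.Unary.All using (All)
open import Data.List.Relation.Unary.Unique.Propositional using (Unique)
open import Data.Nat.Base using (ℕ; zero; suc; _+_; _*_; _∸_; _<_; _≤_; _/_)
open import Data.Nat.Combinatorics using (_C_)
open import Data.Product.Base using (∃-syntax; _×_; _,_)
open import Data.Tree.Binary using (Tree; leaf; node; #nodes; module Suffix)
open import Data.Unit.Base using (⊤)
open import Data.Vec.Base using (Vec; []; _∷_; head; lookup)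
open import Function.Bundles using (_⇔_)
open import Relation.Binary.PropositionalEquality
  using (_≡_; refl; trans; cong; module ≡-Reasoning)

open Algebra.Properties.Monoid.Sum ℤ.+-0-monoid using (sum-syntax; sum-cong-≗)

-- The division is exact.
catalan : ℕ → ℕ
catalan n = ((2 * n) C n) / suc n

-- The right-hand side of the recurrence for A_m with m = suc n, where
-- `prev i` stands for A_{m-j} and j = suc (toℕ i) runs over 1, …, m - 1.
lassalleStep : (n : ℕ) → (Fin n → ℤ) → ℤ
lassalleStep n prev =
  -1ℤ ℤ.^ (m ∸ 1) ℤ.* + catalan m ℤ.+
  (∑[ i < n ] (let j = suc (toℕ i) in
    -1ℤ ℤ.^ (j ∸ 1) ℤ.* + ((2 * m ∸ 1) C (2 * m ∸ 2 * j ∸ 1))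
      ℤ.* prev i ℤ.* + catalan j))
  where m = suc n

-- A_n ∷ … ∷ A_1 ∷ []
lassalleHistory : (n : ℕ) → Vec ℤ n
lassalleHistory zero    = []
lassalleHistory (suc n) =
  lassalleStep n (lookup (lassalleHistory n)) ∷ lassalleHistory n

-- Indexed as A_1, A_2, …; the value at 0 is a dummy.
lassalle : ℕ → ℤ
lassalle zero    = 0ℤ
lassalle (suc n) = head (lassalleHistory (suc n))

lassalle-1 : lassalle 1 ≡ + 1
lassalle-1 = refl

lookup-lassalleHistory : ∀ n (i : Fin n) →
  lookup (lassalleHistory n) i ≡ lassalle (n ∸ toℕ i)
lookup-lassalleHistory (suc n) zero    = refl
lookup-lassalleHistory (suc n) (suc i) = lookup-lassalleHistory n i

lassalle-rec : ∀ n → let m = suc n in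
  lassalle m ≡
    -1ℤ ℤ.^ (m ∸ 1) ℤ.* + catalan m ℤ.+
    (∑[ i < m ∸ 1 ] (let j = suc (toℕ i) in
      -1ℤ ℤ.^ (j ∸ 1) ℤ.* + ((2 * m ∸ 1) C (2 * m ∸ 2 * j ∸ 1))
        ℤ.* lassalle (m ∸ j) ℤ.* + catalan j))
lassalle-rec n =
  cong (λ s → -1ℤ ℤ.^ n ℤ.* + catalan (suc n) ℤ.+ s)
    (sum-cong-≗ {n} (λ i → cong (λ a → coeff i ℤ.* a ℤ.* + catalan (suc (toℕ i)))
                           (lookup-lassalleHistory n i)))
  where
  coeff : Fin n → ℤ
  coeff i = -1ℤ ℤ.^ toℕ i ℤ.*
    + ((2 * suc n ∸ 1) C (2 * suc n ∸ 2 * suc (toℕ i) ∸ 1))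

-- The vertices are the `node`s; `leaf` marks an absent left or right child
-- (so it carries no data, and on its own it is the empty tree).
LabeledTree : Set
LabeledTree = Tree ℕ ⊤

postorder : LabeledTree → List ℕ
postorder = Suffix.toList

postorder-node : ∀ l x r →
  postorder (node l x r) ≡ postorder l ++ postorder r ++ [ x ]
postorder-node l x r =
  trans (toDiffList-++ l _) (cong (postorder l ++_) (toDiffList-++ r [ x ]))
  where
  toDiffList-++ : ∀ (t : LabeledTree) ys →
    Suffix.toDiffList t ys ≡ postorder t ++ ys
  toDiffList-++ (leaf _)     ys = refl
  toDiffList-++ (node l x r) ys = begin
    Suffix.toDiffList l (Suffix.toDiffList r (x ∷ ys))
      ≡⟨ toDiffList-++ l _ ⟩
    postorder l ++ Suffix.toDiffList r (x ∷ ys)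
      ≡⟨ cong (postorder l ++_) (toDiffList-++ r _) ⟩
    postorder l ++ postorder r ++ [ x ] ++ ys
      ≡⟨ cong (postorder l ++_) (++-assoc (postorder r) [ x ] ys) ⟨
    postorder l ++ (postorder r ++ [ x ]) ++ ys
      ≡⟨ ++-assoc (postorder l) (postorder r ++ [ x ]) ys ⟨
    (postorder l ++ postorder r ++ [ x ]) ++ ys
      ≡⟨ cong (λ zs → (postorder l ++ zs) ++ ys) (toDiffList-++ r [ x ]) ⟨
    (postorder l ++ Suffix.toDiffList r [ x ]) ++ ys
      ≡⟨ cong (_++ ys) (toDiffList-++ l _) ⟨
    postorder (node l x r) ++ ys ∎
    where open ≡-Reasoning

data RootBelow (x : ℕ) : LabeledTree → Set where
  leaf : ∀ {u} → RootBelow x (leaf u)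
  node : ∀ {l y r} → y < x → RootBelow x (node l y r)

data Decreasing : LabeledTree → Set where
  leaf : ∀ {u} → Decreasing (leaf u)
  node : ∀ {l x r} → RootBelow x l → RootBelow x r →
         Decreasing l → Decreasing r → Decreasing (node l x r)

record IsDecreasingBinaryPlaneTree (t : LabeledTree) : Set where
  field
    nonEmpty   : 0 < #nodes t
    positive   : All (0 <_) (postorder t)
    distinct   : Unique (postorder t)
    decreasing : Decreasing t

Normalized : LabeledTree → Set
Normalized t = ∃[ n ] (∀ x → x ∈ postorder t ⇔ (1 ≤ x × x ≤ n))

Lonely : LabeledTree → Set
Lonely t = ∀ t′ → IsDecreasingBinaryPlaneTree t′ →
           postorder t′ ≡ postorder t → t′ ≡ t

record IsNormalizedLonely (t : LabeledTree) : Set where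
  field
    isDecreasingBinaryPlaneTree : IsDecreasingBinaryPlaneTree t
    normalized                  : Normalized t
    lonely                      : Lonely t

-- Exactly N elements satisfy P: they can be listed without repetition in
-- a list of length N.
HasCardinality : {A : Set} → (A → Set) → ℕ → Set
HasCardinality {A} P N =
  ∃[ xs ] (Unique xs × (∀ (x : A) → x ∈ xs ⇔ P x) × length xs ≡ N)

{-# OPTIONS --safe #-}
module Submission where

-- A tree is lonely exactly when it is good: every vertex has zero or two
-- children, and in the second case the first label in the postorder of the right
-- subtree is smaller than the root of the left subtree.  Otherwise an only child
-- can change side, or the left subtree can be grafted below the first vertex of
-- the right subtree.  Conversely a tree has at least 2d + 1 vertices, where d is
-- the number of descents of its postorder, with equality exactly for good trees,
-- and in a good tree the descents tell the leaves from the other vertices, so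
-- that the postorder can be parsed.
--
-- Let G(x, y) be the exponential generating function of good trees by the numbers
-- of labels below and above the first label.  Put K(s, t) = G(s, t - s), and let
-- A(t) = ∫₀ᵗ K(s, t) ds count all good trees.  Removing the root, and subtracting
-- the pairs in which the first label u of the right subtree exceeds the whole left
-- subtree, gives  ∂ₜK(s, t) = K(s, t) A(t) - ∫ₛᵗ K(s, u) K(u, t) du.
-- With J = Σ (-1)ᵏ Cₖ z²ᵏ/(2k)!, for which J′ = - ∫₀ᵗ J(u) J(t - u) du, the solution
-- is K(s, t) = J(s) J(t - s) / J(t).  Hence A J = - J′, which is Lassalle's
-- recurrence.

open import Defs
open import Data.Integer.Base using (+_)
open import Data.Nat.Base using (ℕ; suc; _+_; _*_)
open import Data.Nat.Divisibility using (_∣_)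
open import Data.Product.Base using (∃-syntax; _×_)
open import Data.Tree.Binary using (#nodes)
open import Relation.Binary.PropositionalEquality using (_≡_)
open import Relation.Nullary.Negation using (¬_)

import Algebra.Properties.Monoid.Sum
open import Data.Fin.Base using (toℕ)
open import Data.Integer.Base as ℤ using (ℤ; 0ℤ; 1ℤ; -1ℤ)
import Data.Integer.Properties as ℤ
open import Data.Integer.Tactic.RingSolver using (solve-∀)
open import Data.List.Base
  using (List; []; _∷_; [_]; _++_; length; map; concatMap; filter; foldl;
         cartesianProductWith; cartesianProduct; applyDownFrom)
open import Data.List.Membership.Propositional using (_∈_; find; lose)
open import Data.List.Membership.Propositional.Properties
open import Data.List.Membership.Propositional.Properties.WithK using (unique∧set⇒bag)
open import Data.List.Properties
  using (++-assoc; ++-conicalˡ; ++-conicalʳ; ∷-injective; ∷-injectiveˡ;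
         length-++; length-map; length-applyDownFrom)
open import Data.List.Relation.Binary.BagAndSetEquality using (∼bag⇒↭)
open import Data.List.Relation.Binary.Disjoint.Propositional using (Disjoint)
open import Data.List.Relation.Binary.Permutation.Propositional
  using (_↭_; prep; ↭-refl; ↭-sym; ↭-trans; ↭-reflexive; ↭⇒↭ₛ)
open import Data.List.Relation.Binary.Permutation.Propositional.Properties
  using (∈-resp-↭; drop-mid; drop-∷; shift; ↭-length; ++⁺; ++-comm; ↭-empty-inv)
import Data.List.Relation.Binary.Permutation.Setoid.Properties as ↭ₛ
import Data.List.Relation.Ternary.Interleaving.Properties as Interleaving
open import Data.List.Relation.Ternary.Interleaving.Propositional
  using (Interleaving; []; consˡ; consʳ; toPermutation)
open import Data.List.Relation.Unary.All as All using (All; []; _∷_)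
import Data.List.Relation.Unary.All.Properties as All
open import Data.List.Relation.Unary.AllPairs as AllPairs using (AllPairs; []; _∷_)
import Data.List.Relation.Unary.AllPairs.Properties as AllPairs
open import Data.List.Relation.Unary.Any using (here; there)
open import Data.List.Relation.Unary.Unique.Propositional using (Unique)
import Data.List.Relation.Unary.Unique.Propositional.Properties as Unique
open import Data.Nat.Base using (zero; _∸_; _≤_; _<_; _>_; z≤n; s≤s; s≤s⁻¹; _!)
open import Data.Nat.Combinatorics using (_C_; nCn≡1; nCk+nC[k+1]≡[n+1]C[k+1]; k![n∸k]!∣n!)
open import Data.Nat.Combinatorics.Specification using (nCk≡n!/k![n-k]!)
open import Data.Nat.DivMod using (m/n*n≡m)
open import Data.Nat.Divisibility using (divides; ∣m+n∣m⇒∣n; ∣1⇒≡1)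
open import Data.Nat.Properties
import Data.Nat.Tactic.RingSolver as ℕ
open import Data.Product.Base using (_,_; proj₁; proj₂; ∃; ∃₂; map₁; map₂)
open import Data.Product.Properties using (,-injectiveˡ)
open import Data.Sum.Base using (_⊎_; inj₁; inj₂)
open import Data.Tree.Binary using (leaf; node; module Suffix)
open import Data.Unit.Base using (⊤; tt)
open import Function.Base using (_∘_)
open import Function.Bundles using (_⇔_; mk⇔; Equivalence)
open import Relation.Binary.Definitions using (tri<; tri≈; tri>)
open import Relation.Binary.PropositionalEquality
  using (refl; sym; trans; cong; cong₂; subst; subst₂; setoid; module ≡-Reasoning)
open import Relation.Nullary.Decidable.Core using (Dec; yes; no)
open import Relation.Nullary.Negation using (contradiction)
open import Relation.Unary using (Decidable)

open Algebra.Properties.Monoid.Sum ℤ.+-0-monoid using (sum-syntax)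
open ≡-Reasoning

-- Sums over splittings and focusings of an n-element set

-- On exponential generating functions in a single variable, splitSum is the
-- product, F a b being weighted by the binomial coefficient of a + b over a.
splitSum : (ℕ → ℕ → ℤ) → ℕ → ℤ
splitSum F zero    = F 0 0
splitSum F (suc n) = splitSum (λ a b → F (suc a) b) n ℤ.+ splitSum (λ a b → F a (suc b)) n

splitSum₂ : (ℕ → ℕ → ℕ → ℕ → ℤ) → ℕ → ℕ → ℤ
splitSum₂ F q p = splitSum (λ q₁ q₂ → splitSum (F q₁ q₂) p) q

-- The sum over a + 1 + b = n; on exponential generating functions it is the
-- convolution ∫ F(s) G(t - s) ds.
focusSum : (ℕ → ℕ → ℤ) → ℕ → ℤ
focusSum F zero    = 0ℤ
focusSum F (suc n) = F 0 n ℤ.+ focusSum (λ a b → F (suc a) b) n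

+-interchange : ∀ a b c d → (a ℤ.+ b) ℤ.+ (c ℤ.+ d) ≡ (a ℤ.+ c) ℤ.+ (b ℤ.+ d)
+-interchange = solve-∀

splitSum-cong : ∀ {F G} n → (∀ a b → a + b ≡ n → F a b ≡ G a b) → splitSum F n ≡ splitSum G n
splitSum-cong zero    eq = eq 0 0 refl
splitSum-cong (suc n) eq = cong₂ ℤ._+_
  (splitSum-cong n (λ a b e → eq (suc a) b (cong suc e)))
  (splitSum-cong n (λ a b e → eq a (suc b) (trans (+-suc a b) (cong suc e))))

splitSum-+ : ∀ F G n → splitSum (λ a b → F a b ℤ.+ G a b) n ≡ splitSum F n ℤ.+ splitSum G n
splitSum-+ F G zero    = refl
splitSum-+ F G (suc n) = trans
  (cong₂ ℤ._+_ (splitSum-+ _ _ n) (splitSum-+ _ _ n))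
  (+-interchange (splitSum (λ a b → F (suc a) b) n) _ _ _)

splitSum-*ˡ : ∀ c F n → splitSum (λ a b → c ℤ.* F a b) n ≡ c ℤ.* splitSum F n
splitSum-*ˡ c F zero    = refl
splitSum-*ˡ c F (suc n) = trans
  (cong₂ ℤ._+_ (splitSum-*ˡ c _ n) (splitSum-*ˡ c _ n))
  (sym (ℤ.*-distribˡ-+ c _ _))

splitSum-*ʳ : ∀ c F n → splitSum (λ a b → F a b ℤ.* c) n ≡ splitSum F n ℤ.* c
splitSum-*ʳ c F n = begin
  splitSum (λ a b → F a b ℤ.* c) n ≡⟨ splitSum-cong n (λ a b _ → ℤ.*-comm (F a b) c) ⟩
  splitSum (λ a b → c ℤ.* F a b) n ≡⟨ splitSum-*ˡ c F n ⟩
  c ℤ.* splitSum F n               ≡⟨ ℤ.*-comm c _ ⟩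
  splitSum F n ℤ.* c               ∎

splitSum-zero : ∀ n → splitSum (λ _ _ → 0ℤ) n ≡ 0ℤ
splitSum-zero n = trans (splitSum-*ˡ 0ℤ (λ _ _ → 0ℤ) n) (ℤ.*-zeroˡ (splitSum (λ _ _ → 0ℤ) n))

splitSum-assoc : ∀ (F : ℕ → ℕ → ℕ → ℤ) n →
  splitSum (λ m c → splitSum (λ a b → F a b c) m) n ≡ splitSum (λ a m → splitSum (F a) m) n
splitSum-assoc F zero    = refl
splitSum-assoc F (suc n) = begin
  splitSum (λ m c → splitSum (λ a b → F (suc a) b c) m ℤ.+ splitSum (λ a b → F a (suc b) c) m) n
    ℤ.+ splitSum (λ m c → splitSum (λ a b → F a b (suc c)) m) n
    ≡⟨ cong₂ ℤ._+_ (splitSum-+ _ _ n) refl ⟩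
  (splitSum (λ m c → splitSum (λ a b → F (suc a) b c) m) n
    ℤ.+ splitSum (λ m c → splitSum (λ a b → F a (suc b) c) m) n)
    ℤ.+ splitSum (λ m c → splitSum (λ a b → F a b (suc c)) m) n
    ≡⟨ ℤ.+-assoc (splitSum (λ m c → splitSum (λ a b → F (suc a) b c) m) n) _ _ ⟩
  splitSum (λ m c → splitSum (λ a b → F (suc a) b c) m) n
    ℤ.+ (splitSum (λ m c → splitSum (λ a b → F a (suc b) c) m) n
    ℤ.+ splitSum (λ m c → splitSum (λ a b → F a b (suc c)) m) n)
    ≡⟨ cong₂ ℤ._+_ (splitSum-assoc _ n) (cong₂ ℤ._+_ (splitSum-assoc _ n) (splitSum-assoc _ n)) ⟩
  splitSum (λ a m → splitSum (F (suc a)) m) n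
    ℤ.+ (splitSum (λ a m → splitSum (λ b c → F a (suc b) c) m) n
    ℤ.+ splitSum (λ a m → splitSum (λ b c → F a b (suc c)) m) n)
    ≡⟨ cong (λ z → splitSum (λ a m → splitSum (F (suc a)) m) n ℤ.+ z) (splitSum-+ _ _ n) ⟨
  splitSum (λ a m → splitSum (F (suc a)) m) n
    ℤ.+ splitSum (λ a m → splitSum (λ b c → F a (suc b) c) m ℤ.+ splitSum (λ b c → F a b (suc c)) m) n ∎

splitSum-swap : ∀ (F : ℕ → ℕ → ℕ → ℕ → ℤ) q p →
  splitSum₂ F q p ≡ splitSum (λ p₁ p₂ → splitSum (λ q₁ q₂ → F q₁ q₂ p₁ p₂) q) p
splitSum-swap F zero    p = refl
splitSum-swap F (suc q) p = trans
  (cong₂ ℤ._+_ (splitSum-swap _ q p) (splitSum-swap _ q p))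
  (sym (splitSum-+ _ _ p))

splitSum-join : ∀ (F : ℕ → ℕ → ℤ) q p →
  splitSum₂ (λ q₁ q₂ p₁ p₂ → F (q₁ + p₁) (q₂ + p₂)) q p ≡ splitSum F (q + p)
splitSum-join F zero    p = refl
splitSum-join F (suc q) p = cong₂ ℤ._+_ (splitSum-join _ q p) (splitSum-join _ q p)

splitSum₂-cong : ∀ {F G} q p →
  (∀ q₁ q₂ p₁ p₂ → q₁ + q₂ ≡ q → p₁ + p₂ ≡ p → F q₁ q₂ p₁ p₂ ≡ G q₁ q₂ p₁ p₂) →
  splitSum₂ F q p ≡ splitSum₂ G q p
splitSum₂-cong q p eq = splitSum-cong q λ q₁ q₂ e → splitSum-cong p λ p₁ p₂ e′ → eq q₁ q₂ p₁ p₂ e e′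

splitSum₂-+ : ∀ F G q p →
  splitSum₂ (λ q₁ q₂ p₁ p₂ → F q₁ q₂ p₁ p₂ ℤ.+ G q₁ q₂ p₁ p₂) q p ≡ splitSum₂ F q p ℤ.+ splitSum₂ G q p
splitSum₂-+ F G q p = trans (splitSum-cong q (λ _ _ _ → splitSum-+ _ _ p)) (splitSum-+ _ _ q)

splitSum₂-*ˡ : ∀ c F q p →
  splitSum₂ (λ q₁ q₂ p₁ p₂ → c ℤ.* F q₁ q₂ p₁ p₂) q p ≡ c ℤ.* splitSum₂ F q p
splitSum₂-*ˡ c F q p = trans (splitSum-cong q (λ _ _ _ → splitSum-*ˡ c _ p)) (splitSum-*ˡ c _ q)

splitSum₂-*ʳ : ∀ c F q p →
  splitSum₂ (λ q₁ q₂ p₁ p₂ → F q₁ q₂ p₁ p₂ ℤ.* c) q p ≡ splitSum₂ F q p ℤ.* c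
splitSum₂-*ʳ c F q p = trans (splitSum-cong q (λ _ _ _ → splitSum-*ʳ c _ p)) (splitSum-*ʳ c _ q)

splitSum₂-assoc : ∀ (F : ℕ → ℕ → ℕ → ℕ → ℕ → ℕ → ℤ) q p →
  splitSum₂ (λ m c n d → splitSum₂ (λ a b a′ b′ → F a b c a′ b′ d) m n) q p ≡
  splitSum₂ (λ a m a′ n → splitSum₂ (λ b c b′ d → F a b c a′ b′ d) m n) q p
splitSum₂-assoc F q p = begin
  splitSum₂ (λ m c n d → splitSum₂ (λ a b a′ b′ → F a b c a′ b′ d) m n) q p
    ≡⟨ splitSum-cong q (λ m c _ → splitSum-swap _ m p) ⟨
  splitSum (λ m c → splitSum (λ a b → splitSum (λ n d → splitSum (λ a′ b′ → F a b c a′ b′ d) n) p) m) q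
    ≡⟨ splitSum-assoc _ q ⟩
  splitSum (λ a m → splitSum (λ b c → splitSum (λ n d → splitSum (λ a′ b′ → F a b c a′ b′ d) n) p) m) q
    ≡⟨ splitSum-cong q (λ a m _ → splitSum-cong m (λ b c _ → splitSum-assoc _ p)) ⟩
  splitSum (λ a m → splitSum (λ b c → splitSum (λ a′ n → splitSum (λ b′ d → F a b c a′ b′ d) n) p) m) q
    ≡⟨ splitSum-cong q (λ a m _ → splitSum-swap _ m p) ⟩
  splitSum₂ (λ a m a′ n → splitSum₂ (λ b c b′ d → F a b c a′ b′ d) m n) q p ∎

focusSum-cong : ∀ {F G} n → (∀ a b → suc (a + b) ≡ n → F a b ≡ G a b) → focusSum F n ≡ focusSum G n
focusSum-cong zero    eq = refl
focusSum-cong (suc n) eq = cong₂ ℤ._+_ (eq 0 n refl)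
  (focusSum-cong n (λ a b e → eq (suc a) b (cong suc e)))

focusSum-+ : ∀ F G n → focusSum (λ a b → F a b ℤ.+ G a b) n ≡ focusSum F n ℤ.+ focusSum G n
focusSum-+ F G zero    = refl
focusSum-+ F G (suc n) = trans
  (cong (λ z → (F 0 n ℤ.+ G 0 n) ℤ.+ z) (focusSum-+ _ _ n))
  (+-interchange (F 0 n) _ _ _)

focusSum-*ˡ : ∀ c F n → focusSum (λ a b → c ℤ.* F a b) n ≡ c ℤ.* focusSum F n
focusSum-*ˡ c F zero    = sym (ℤ.*-zeroʳ c)
focusSum-*ˡ c F (suc n) = trans
  (cong (λ z → c ℤ.* F 0 n ℤ.+ z) (focusSum-*ˡ c _ n))
  (sym (ℤ.*-distribˡ-+ c _ _))

focusSum-*ʳ : ∀ c F n → focusSum (λ a b → F a b ℤ.* c) n ≡ focusSum F n ℤ.* c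
focusSum-*ʳ c F n = begin
  focusSum (λ a b → F a b ℤ.* c) n ≡⟨ focusSum-cong n (λ a b _ → ℤ.*-comm (F a b) c) ⟩
  focusSum (λ a b → c ℤ.* F a b) n ≡⟨ focusSum-*ˡ c F n ⟩
  c ℤ.* focusSum F n               ≡⟨ ℤ.*-comm c _ ⟩
  focusSum F n ℤ.* c               ∎

splitSum-focusSum : ∀ (F : ℕ → ℕ → ℕ → ℕ → ℤ) q p →
  splitSum (λ p₁ p₂ → focusSum (λ a b → F a b p₁ p₂) q) p ≡ focusSum (λ a b → splitSum (F a b) p) q
splitSum-focusSum F zero    p = splitSum-zero p
splitSum-focusSum F (suc q) p = trans (splitSum-+ _ _ p)
  (cong (λ z → splitSum (F 0 q) p ℤ.+ z) (splitSum-focusSum _ q p))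

-- Focusing obeys a Leibniz rule: elements before and after the focus are split
-- independently.
splitSum-focusˡ : ∀ (F : ℕ → ℕ → ℕ → ℤ) n →
  splitSum (λ m c → focusSum (λ a b → F a b c) m) n ≡
  focusSum (λ a b → splitSum (λ a₁ a₂ → splitSum (λ b₁ b₂ → F a₁ b₁ (a₂ + b₂)) b) a) n
splitSum-focusˡ F zero    = refl
splitSum-focusˡ F (suc n) = begin
  splitSum (λ m c → F 0 m c ℤ.+ focusSum (λ a b → F (suc a) b c) m) n
    ℤ.+ splitSum (λ m c → focusSum (λ a b → F a b (suc c)) m) n
    ≡⟨ cong₂ ℤ._+_ (splitSum-+ _ _ n) refl ⟩
  (splitSum (F 0) n ℤ.+ splitSum (λ m c → focusSum (λ a b → F (suc a) b c) m) n)
    ℤ.+ splitSum (λ m c → focusSum (λ a b → F a b (suc c)) m) n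
    ≡⟨ cong₂ (λ x y → (splitSum (F 0) n ℤ.+ x) ℤ.+ y) (splitSum-focusˡ _ n) (splitSum-focusˡ _ n) ⟩
  (splitSum (F 0) n ℤ.+ focusSum (λ a b → splitSum (λ a₁ a₂ → splitSum (λ b₁ b₂ → F (suc a₁) b₁ (a₂ + b₂)) b) a) n)
    ℤ.+ focusSum (λ a b → splitSum (λ a₁ a₂ → splitSum (λ b₁ b₂ → F a₁ b₁ (suc (a₂ + b₂))) b) a) n
    ≡⟨ ℤ.+-assoc (splitSum (F 0) n) _ _ ⟩
  splitSum (F 0) n ℤ.+
    (focusSum (λ a b → splitSum (λ a₁ a₂ → splitSum (λ b₁ b₂ → F (suc a₁) b₁ (a₂ + b₂)) b) a) n
    ℤ.+ focusSum (λ a b → splitSum (λ a₁ a₂ → splitSum (λ b₁ b₂ → F a₁ b₁ (suc (a₂ + b₂))) b) a) n)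
    ≡⟨ cong (λ z → splitSum (F 0) n ℤ.+ z) (focusSum-+ _ _ n) ⟨
  _ ∎


-- The generating-function identity

≤-partˡ : ∀ a b {n} → a + b ≡ n → a ≤ n
≤-partˡ a b refl = m≤m+n a b

≤-partʳ : ∀ a b {n} → a + b ≡ n → b ≤ n
≤-partʳ a b refl = m≤n+m b a

-- In badPairs, α labels lie above the first label u of the right subtree, and β lie
-- between u and the first label of the tree.
allPairs badPairs : (ℕ → ℕ → ℤ) → ℕ → ℕ → ℤ
allPairs c = splitSum₂ (λ q₁ q₂ p₁ p₂ → c q₁ p₁ ℤ.* focusSum c (q₂ + p₂))
badPairs c q p =
  focusSum (λ α β → splitSum₂ (λ β₁ β₂ p₁ p₂ → c β₁ p₁ ℤ.* c α (β₂ + p₂)) β p) q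

removeMax : (ℕ → ℕ → ℤ) → ℕ → ℕ → ℤ
removeMax c q p = allPairs c q p ℤ.- badPairs c q p

removeMax-cong : ∀ {c d} q p → (∀ a b → a + b ≤ q + p → c a b ≡ d a b) →
  removeMax c q p ≡ removeMax d q p
removeMax-cong q p eq = cong₂ ℤ._-_
  (splitSum₂-cong q p λ q₁ q₂ p₁ p₂ e e′ → cong₂ ℤ._*_
    (eq q₁ p₁ (+-mono-≤ (≤-partˡ q₁ q₂ e) (≤-partˡ p₁ p₂ e′)))
    (focusSum-cong (q₂ + p₂) λ a b e″ → eq a b
      (≤-trans (<⇒≤ (≤-reflexive e″)) (+-mono-≤ (≤-partʳ q₁ q₂ e) (≤-partʳ p₁ p₂ e′)))))
  (focusSum-cong q λ α β e → splitSum₂-cong β p λ β₁ β₂ p₁ p₂ e′ e″ → cong₂ ℤ._*_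
    (eq β₁ p₁ (+-mono-≤ (≤-trans (≤-partˡ β₁ β₂ e′) (≤-partʳ (suc α) β e)) (≤-partˡ p₁ p₂ e″)))
    (eq α (β₂ + p₂) (≤-trans (≤-reflexive (sym (+-assoc α β₂ p₂)))
      (+-mono-≤ (≤-trans (+-monoʳ-≤ α (≤-partʳ β₁ β₂ e′)) (<⇒≤ (≤-reflexive e)))
        (≤-partʳ p₁ p₂ e″)))))

-- q and p count the labels above and below the first one; n is fuel.
countFrom : ℕ → ℕ → ℕ → ℤ
countFrom n       zero    zero    = 1ℤ
countFrom n       zero    (suc p) = 0ℤ
countFrom zero    (suc q) p       = 0ℤ
countFrom (suc n) (suc q) p       = removeMax (countFrom n) q p

countFrom-fuel : ∀ m n q p → q + p ≤ m → q + p ≤ n → countFrom m q p ≡ countFrom n q p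
countFrom-fuel m       n       zero    zero    _        _        = refl
countFrom-fuel m       n       zero    (suc p) _        _        = refl
countFrom-fuel (suc m) (suc n) (suc q) p       (s≤s lm) (s≤s ln) =
  removeMax-cong q p λ a b l → countFrom-fuel m n a b (≤-trans l lm) (≤-trans l ln)

count : ℕ → ℕ → ℤ
count q p = countFrom (q + p) q p

count-fuel : ∀ n q p → q + p ≤ n → countFrom n q p ≡ count q p
count-fuel n q p l = countFrom-fuel n (q + p) q p l ≤-refl

count-suc : ∀ q p → count (suc q) p ≡ removeMax count q p
count-suc q p = removeMax-cong q p (λ a b → count-fuel (q + p) a b)

module _ (j : ℕ → ℤ) (j-zero : j 0 ≡ 1ℤ)
         (j-suc : ∀ n → j (suc n) ≡ ℤ.- focusSum (λ a b → j a ℤ.* j b) n) where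

  count-*-j : ℕ → ℕ → ℤ
  count-*-j = splitSum₂ (λ q₁ q₂ p₁ p₂ → count q₁ p₁ ℤ.* j (q₂ + p₂))

  total-*-j : ∀ m → (∀ a b → suc (a + b) ≡ m → count-*-j a b ≡ j a ℤ.* j b) →
    splitSum (λ a b → focusSum count a ℤ.* j b) m ≡ ℤ.- j (suc m)
  total-*-j m ih = begin
    splitSum (λ a b → focusSum count a ℤ.* j b) m
      ≡⟨ splitSum-cong m (λ a b _ → focusSum-*ʳ (j b) count a) ⟨
    splitSum (λ a b → focusSum (λ c d → count c d ℤ.* j b) a) m
      ≡⟨ splitSum-focusˡ _ m ⟩
    focusSum count-*-j m
      ≡⟨ focusSum-cong m ih ⟩
    focusSum (λ a b → j a ℤ.* j b) m
      ≡⟨ ℤ.neg-involutive _ ⟨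
    ℤ.- ℤ.- focusSum (λ a b → j a ℤ.* j b) m
      ≡⟨ cong ℤ.-_ (j-suc m) ⟨
    ℤ.- j (suc m) ∎

  good-term : ∀ q p → (∀ a b → a + b < q + p → count-*-j a b ≡ j a ℤ.* j b) →
    splitSum₂ (λ q₁ q₂ p₁ p₂ → allPairs count q₁ p₁ ℤ.* j (q₂ + p₂)) q p
    ≡ ℤ.- splitSum₂ (λ q₁ q₂ p₁ p₂ → count q₁ p₁ ℤ.* j (suc (q₂ + p₂))) q p
  good-term q p ih = begin
    splitSum₂ (λ q₁ q₂ p₁ p₂ → allPairs count q₁ p₁ ℤ.* j (q₂ + p₂)) q p
      ≡⟨ splitSum₂-cong q p (λ q₁ q₂ p₁ p₂ _ _ → splitSum₂-*ʳ (j (q₂ + p₂)) _ q₁ p₁) ⟨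
    splitSum₂ (λ q₁ q₂ p₁ p₂ →
      splitSum₂ (λ a b c d → count a c ℤ.* focusSum count (b + d) ℤ.* j (q₂ + p₂)) q₁ p₁) q p
      ≡⟨ splitSum₂-assoc (λ a b q₂ c d p₂ → count a c ℤ.* focusSum count (b + d) ℤ.* j (q₂ + p₂)) q p ⟩
    splitSum₂ (λ a m c n →
      splitSum₂ (λ b q₂ d p₂ → count a c ℤ.* focusSum count (b + d) ℤ.* j (q₂ + p₂)) m n) q p
      ≡⟨ splitSum₂-cong q p (λ a m c n e e′ → trans
           (splitSum₂-cong m n (λ b q₂ d p₂ _ _ → ℤ.*-assoc (count a c) _ _))
           (trans (splitSum₂-*ˡ (count a c) _ m n) (cong (count a c ℤ.*_) (inner a m c n e e′)))) ⟩
    splitSum₂ (λ a m c n → count a c ℤ.* (ℤ.- j (suc (m + n)))) q p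
      ≡⟨ splitSum₂-cong q p (λ a m c n _ _ → *-neg (count a c) (j (suc (m + n)))) ⟩
    splitSum₂ (λ a m c n → -1ℤ ℤ.* (count a c ℤ.* j (suc (m + n)))) q p
      ≡⟨ splitSum₂-*ˡ -1ℤ _ q p ⟩
    -1ℤ ℤ.* splitSum₂ (λ q₁ q₂ p₁ p₂ → count q₁ p₁ ℤ.* j (suc (q₂ + p₂))) q p
      ≡⟨ ℤ.-1*i≡-i _ ⟩
    ℤ.- splitSum₂ (λ q₁ q₂ p₁ p₂ → count q₁ p₁ ℤ.* j (suc (q₂ + p₂))) q p ∎
    where
    *-neg : ∀ x y → x ℤ.* (ℤ.- y) ≡ -1ℤ ℤ.* (x ℤ.* y)
    *-neg = solve-∀
    inner : ∀ a m c n → a + m ≡ q → c + n ≡ p →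
      splitSum₂ (λ b q₂ d p₂ → focusSum count (b + d) ℤ.* j (q₂ + p₂)) m n ≡ ℤ.- j (suc (m + n))
    inner a m c n e e′ = trans (splitSum-join (λ x y → focusSum count x ℤ.* j y) m n)
      (total-*-j (m + n) λ x y e″ → ih x y
        (≤-trans (≤-reflexive e″) (+-mono-≤ (≤-partʳ a m e) (≤-partʳ c n e′))))

  bad-term : ∀ q p → (∀ a b → a + b < q + p → count-*-j a b ≡ j a ℤ.* j b) →
    splitSum₂ (λ q₁ q₂ p₁ p₂ → badPairs count q₁ p₁ ℤ.* j (q₂ + p₂)) q p
    ≡ focusSum (λ α β → j α ℤ.* (j β ℤ.* j p)) q
  bad-term q p ih = begin
    splitSum₂ (λ q₁ q₂ p₁ p₂ → badPairs count q₁ p₁ ℤ.* j (q₂ + p₂)) q p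
      ≡⟨ splitSum-cong q (λ q₁ q₂ _ → trans
           (splitSum-cong p (λ p₁ p₂ _ → sym (focusSum-*ʳ (j (q₂ + p₂)) _ q₁)))
           (splitSum-focusSum (λ α β p₁ p₂ → X α β p₁ ℤ.* j (q₂ + p₂)) q₁ p)) ⟩
    splitSum (λ q₁ q₂ → focusSum (λ α β →
      splitSum (λ p₁ p₂ → X α β p₁ ℤ.* j (q₂ + p₂)) p) q₁) q
      ≡⟨ splitSum-focusˡ (λ α β q₂ → splitSum (λ p₁ p₂ → X α β p₁ ℤ.* j (q₂ + p₂)) p) q ⟩
    focusSum (λ α β → splitSum (λ α₁ α₂ →
      splitSum₂ (λ β₁ β₂ p₁ p₂ → X α₁ β₁ p₁ ℤ.* j ((α₂ + β₂) + p₂)) β p) α) q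
      ≡⟨ focusSum-cong q below ⟩
    focusSum (λ α β → j α ℤ.* (j β ℤ.* j p)) q ∎
    where
    X : ℕ → ℕ → ℕ → ℤ
    X α β p₁ = splitSum₂ (λ b m c n → count b c ℤ.* count α (m + n)) β p₁

    split-R : ∀ α₁ α₂ β →
      splitSum₂ (λ β₁ β₂ p₁ p₂ → X α₁ β₁ p₁ ℤ.* j ((α₂ + β₂) + p₂)) β p ≡
      splitSum₂ (λ b m c n → count b c ℤ.* splitSum (λ s t → count α₁ s ℤ.* j (α₂ + t)) (m + n)) β p
    split-R α₁ α₂ β = begin
      splitSum₂ (λ β₁ β₂ p₁ p₂ → X α₁ β₁ p₁ ℤ.* j ((α₂ + β₂) + p₂)) β p
        ≡⟨ splitSum₂-cong β p (λ β₁ β₂ p₁ p₂ _ _ → sym (splitSum₂-*ʳ (j ((α₂ + β₂) + p₂)) _ β₁ p₁)) ⟩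
      splitSum₂ (λ β₁ β₂ p₁ p₂ →
        splitSum₂ (λ b m c n → count b c ℤ.* count α₁ (m + n) ℤ.* j ((α₂ + β₂) + p₂)) β₁ p₁) β p
        ≡⟨ splitSum₂-assoc (λ b m β₂ c n p₂ → count b c ℤ.* count α₁ (m + n) ℤ.* j ((α₂ + β₂) + p₂)) β p ⟩
      splitSum₂ (λ b m c n →
        splitSum₂ (λ m₁ β₂ n₁ p₂ → count b c ℤ.* count α₁ (m₁ + n₁) ℤ.* j ((α₂ + β₂) + p₂)) m n) β p
        ≡⟨ splitSum₂-cong β p (λ b m c n _ _ → trans
             (splitSum₂-cong m n (λ m₁ β₂ n₁ p₂ _ _ → trans
               (ℤ.*-assoc (count b c) _ _)
               (cong (λ z → count b c ℤ.* (count α₁ (m₁ + n₁) ℤ.* j z)) (+-assoc α₂ β₂ p₂))))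
             (trans (splitSum₂-*ˡ (count b c) _ m n)
               (cong (count b c ℤ.*_) (splitSum-join (λ s t → count α₁ s ℤ.* j (α₂ + t)) m n)))) ⟩
      splitSum₂ (λ b m c n → count b c ℤ.* splitSum (λ s t → count α₁ s ℤ.* j (α₂ + t)) (m + n)) β p ∎

    below : ∀ α β → suc (α + β) ≡ q →
      splitSum (λ α₁ α₂ → splitSum₂ (λ β₁ β₂ p₁ p₂ → X α₁ β₁ p₁ ℤ.* j ((α₂ + β₂) + p₂)) β p) α
      ≡ j α ℤ.* (j β ℤ.* j p)
    below α β e = begin
      splitSum (λ α₁ α₂ → splitSum₂ (λ β₁ β₂ p₁ p₂ → X α₁ β₁ p₁ ℤ.* j ((α₂ + β₂) + p₂)) β p) α
        ≡⟨ splitSum-cong α (λ α₁ α₂ _ → split-R α₁ α₂ β) ⟩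
      splitSum (λ α₁ α₂ → splitSum₂ (λ b m c n → count b c ℤ.*
        splitSum (λ s t → count α₁ s ℤ.* j (α₂ + t)) (m + n)) β p) α
        ≡⟨ splitSum-swap _ α β ⟩
      splitSum (λ b m → splitSum (λ α₁ α₂ → splitSum (λ c n → count b c ℤ.*
        splitSum (λ s t → count α₁ s ℤ.* j (α₂ + t)) (m + n)) p) α) β
        ≡⟨ splitSum-cong β (λ b m _ → splitSum-swap _ α p) ⟩
      splitSum₂ (λ b m c n → splitSum (λ α₁ α₂ → count b c ℤ.*
        splitSum (λ s t → count α₁ s ℤ.* j (α₂ + t)) (m + n)) α) β p
        ≡⟨ splitSum₂-cong β p (λ b m c n e₁ e₂ → trans (splitSum-*ˡ (count b c) _ α)
             (cong (count b c ℤ.*_) (ih α (m + n) (smaller b m c n e₁ e₂)))) ⟩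
      splitSum₂ (λ b m c n → count b c ℤ.* (j α ℤ.* j (m + n))) β p
        ≡⟨ splitSum₂-cong β p (λ b m c n _ _ → *-left-comm (count b c) (j α) (j (m + n))) ⟩
      splitSum₂ (λ b m c n → j α ℤ.* (count b c ℤ.* j (m + n))) β p
        ≡⟨ splitSum₂-*ˡ (j α) _ β p ⟩
      j α ℤ.* count-*-j β p
        ≡⟨ cong (j α ℤ.*_) (ih β p (+-monoˡ-≤ p (≤-partʳ α (suc β) (trans (+-suc α β) e)))) ⟩
      j α ℤ.* (j β ℤ.* j p) ∎
      where
      *-left-comm : ∀ x y z → x ℤ.* (y ℤ.* z) ≡ y ℤ.* (x ℤ.* z)
      *-left-comm = solve-∀
      smaller : ∀ b m c n → b + m ≡ β → c + n ≡ p → α + (m + n) < q + p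
      smaller b m c n e₁ e₂ = subst₂ _≤_ (cong suc (+-assoc α m n)) (cong (_+ p) e)
        (+-mono-≤ (s≤s (+-monoʳ-≤ α (≤-partʳ b m e₁))) (≤-partʳ c n e₂))

  count-*-j≡j*j : ∀ n q p → q + p ≤ n → count-*-j q p ≡ j q ℤ.* j p
  count-*-j≡j*j n zero    p       _       = begin
    splitSum (λ p₁ p₂ → count 0 p₁ ℤ.* j p₂) p ≡⟨ only-empty j p ⟩
    j p                                       ≡⟨ ℤ.*-identityˡ (j p) ⟨
    1ℤ ℤ.* j p                                ≡⟨ cong (ℤ._* j p) j-zero ⟨
    j 0 ℤ.* j p                               ∎
    where
    only-empty : ∀ (f : ℕ → ℤ) p → splitSum (λ p₁ p₂ → count 0 p₁ ℤ.* f p₂) p ≡ f p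
    only-empty f zero    = ℤ.*-identityˡ (f 0)
    only-empty f (suc p) = trans
      (cong₂ ℤ._+_ (trans (splitSum-cong p (λ _ b _ → ℤ.*-zeroˡ (f b))) (splitSum-zero p))
                   (only-empty (λ x → f (suc x)) p))
      (ℤ.+-identityˡ (f (suc p)))
  count-*-j≡j*j (suc n) (suc q) p (s≤s l) = begin
    splitSum₂ (λ q₁ q₂ p₁ p₂ → count (suc q₁) p₁ ℤ.* j (q₂ + p₂)) q p ℤ.+ R
      ≡⟨ cong (ℤ._+ R) (splitSum₂-cong q p (λ q₁ q₂ p₁ p₂ _ _ →
           trans (cong (ℤ._* j (q₂ + p₂)) (count-suc q₁ p₁)) (*-distribʳ-- (allPairs count q₁ p₁) (badPairs count q₁ p₁) (j (q₂ + p₂))))) ⟩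
    splitSum₂ (λ q₁ q₂ p₁ p₂ → allPairs count q₁ p₁ ℤ.* j (q₂ + p₂)
      ℤ.+ -1ℤ ℤ.* (badPairs count q₁ p₁ ℤ.* j (q₂ + p₂))) q p
      ℤ.+ R
      ≡⟨ cong (ℤ._+ R) (trans (splitSum₂-+ _ _ q p) (cong₂ ℤ._+_ (good-term q p ih)
           (trans (splitSum₂-*ˡ -1ℤ _ q p) (cong (-1ℤ ℤ.*_) (bad-term q p ih))))) ⟩
    (ℤ.- R ℤ.+ -1ℤ ℤ.* focusSum (λ α β → j α ℤ.* (j β ℤ.* j p)) q) ℤ.+ R
      ≡⟨ cancel R _ ⟩
    ℤ.- focusSum (λ α β → j α ℤ.* (j β ℤ.* j p)) q
      ≡⟨ cong ℤ.-_ (trans (focusSum-cong q (λ α β _ → sym (ℤ.*-assoc (j α) (j β) (j p))))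
                          (focusSum-*ʳ (j p) _ q)) ⟩
    ℤ.- (focusSum (λ α β → j α ℤ.* j β) q ℤ.* j p)
      ≡⟨ ℤ.neg-distribˡ-* (focusSum (λ α β → j α ℤ.* j β) q) (j p) ⟩
    ℤ.- focusSum (λ α β → j α ℤ.* j β) q ℤ.* j p
      ≡⟨ cong (ℤ._* j p) (j-suc q) ⟨
    j (suc q) ℤ.* j p ∎
    where
    R = splitSum₂ (λ q₁ q₂ p₁ p₂ → count q₁ p₁ ℤ.* j (suc (q₂ + p₂))) q p
    ih : ∀ a b → a + b < q + p → count-*-j a b ≡ j a ℤ.* j b
    ih a b a+b<q+p = count-*-j≡j*j n a b (≤-trans (<⇒≤ a+b<q+p) l)
    *-distribʳ-- : ∀ x y z → (x ℤ.- y) ℤ.* z ≡ x ℤ.* z ℤ.+ -1ℤ ℤ.* (y ℤ.* z)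
    *-distribʳ-- = solve-∀
    cancel : ∀ x y → (ℤ.- x ℤ.+ -1ℤ ℤ.* y) ℤ.+ x ≡ ℤ.- y
    cancel = solve-∀

  total-recurrence : ∀ m → splitSum (λ a b → focusSum count a ℤ.* j b) m ≡ ℤ.- j (suc m)
  total-recurrence m = total-*-j m (λ a b _ → count-*-j≡j*j (a + b) a b ≤-refl)

focusSum-last : ∀ F n → focusSum F (suc n) ≡ focusSum (λ a b → F a (suc b)) n ℤ.+ F n 0
focusSum-last F zero    = ℤ.+-comm (F 0 0) 0ℤ
focusSum-last F (suc n) = trans
  (cong (λ z → F 0 (suc n) ℤ.+ z) (focusSum-last (λ a b → F (suc a) b) n))
  (sym (ℤ.+-assoc (F 0 (suc n)) _ _))

focusSum-flip : ∀ F n → focusSum (λ a b → F b a) n ≡ focusSum F n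
focusSum-flip F zero    = refl
focusSum-flip F (suc n) = begin
  F n 0 ℤ.+ focusSum (λ a b → F b (suc a)) n ≡⟨ cong (λ z → F n 0 ℤ.+ z) (focusSum-flip (λ a b → F a (suc b)) n) ⟩
  F n 0 ℤ.+ focusSum (λ a b → F a (suc b)) n ≡⟨ ℤ.+-comm (F n 0) _ ⟩
  focusSum (λ a b → F a (suc b)) n ℤ.+ F n 0 ≡⟨ focusSum-last F n ⟨
  focusSum F (suc n)                         ∎

splitSum-binomial : ∀ F n → splitSum F n ≡ focusSum (λ a b → + ((a + b) C a) ℤ.* F a b) (suc n)
splitSum-binomial F zero    = sym (trans (ℤ.+-identityʳ _) (ℤ.*-identityˡ (F 0 0)))
splitSum-binomial F (suc n) = sym (begin
  focusSum (λ a b → + ((a + b) C a) ℤ.* F a b) (suc (suc n))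
    ≡⟨ focusSum-cong (suc (suc n)) (λ a b e → trans (cong (ℤ._* F a b) (pascal a b (suc-injective e)))
                                                 (ℤ.*-distribʳ-+ (F a b) (u a b) (v a b))) ⟩
  focusSum (λ a b → u a b ℤ.* F a b ℤ.+ v a b ℤ.* F a b) (suc (suc n))
    ≡⟨ focusSum-+ (λ a b → u a b ℤ.* F a b) (λ a b → v a b ℤ.* F a b) (suc (suc n)) ⟩
  focusSum (λ a b → u a b ℤ.* F a b) (suc (suc n)) ℤ.+ focusSum (λ a b → v a b ℤ.* F a b) (suc (suc n))
    ≡⟨ cong₂ ℤ._+_ (zero-first (F 0 (suc n)) X)
         (trans (focusSum-last (λ a b → v a b ℤ.* F a b) (suc n)) (zero-last (F (suc n) 0) Y)) ⟩
  X ℤ.+ Y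
    ≡⟨ cong₂ ℤ._+_ (splitSum-binomial _ n) (splitSum-binomial _ n) ⟨
  splitSum F (suc n) ∎)
  where
  X = focusSum (λ a b → + ((a + b) C a) ℤ.* F (suc a) b) (suc n)
  Y = focusSum (λ a b → + ((a + b) C a) ℤ.* F a (suc b)) (suc n)
  zero-first : ∀ x y → 0ℤ ℤ.* x ℤ.+ y ≡ y
  zero-first = solve-∀
  zero-last : ∀ x y → y ℤ.+ 0ℤ ℤ.* x ≡ y
  zero-last = solve-∀
  u v : ℕ → ℕ → ℤ
  u zero    b = 0ℤ
  u (suc a) b = + ((a + b) C a)
  v a zero    = 0ℤ
  v a (suc b) = + ((a + b) C a)
  pascal : ∀ a b → a + b ≡ suc n → + ((a + b) C a) ≡ u a b ℤ.+ v a b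
  pascal zero    (suc b) e = refl
  pascal (suc a) zero    e rewrite +-identityʳ a | nCn≡1 a | nCn≡1 (suc a) = refl
  pascal (suc a) (suc b) e = trans (cong +_ (sym (nCk+nC[k+1]≡[n+1]C[k+1] (a + suc b) a)))
    (trans (ℤ.pos-+ ((a + suc b) C a) _) (cong (λ m → + ((a + suc b) C a) ℤ.+ + (m C suc a)) (+-suc a b)))

-- Catalan numbers

C-factorial : ∀ a b → ((a + b) C a) * (a ! * b !) ≡ (a + b) !
C-factorial a b = trans
  (cong₂ _*_ (nCk≡n!/k![n-k]! (m≤m+n a b)) (cong (λ m → a ! * m !) (sym (m+n∸m≡n a b))))
  (m/n*n≡m {{a !* (a + b ∸ a) !≢0}} (k![n∸k]!∣n! (m≤m+n a b)))

suc∣central : ∀ n → suc n ∣ (n + n) C n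
suc∣central zero    = divides 1 refl
suc∣central (suc m) = ∣m+n∣m⇒∣n
  (divides ((n + n) C n) (add-one n ((n + n) C n)))
  (divides d absorb)
  where
  n = suc m
  d = (n + n) C suc n
  add-one : ∀ x y → x * y + y ≡ y * (1 + x)
  add-one = ℕ.solve-∀
  regroup : ∀ x y z w → x * (1 + y) * (z * w) ≡ x * ((1 + y) * z * w)
  regroup = ℕ.solve-∀
  regroup′ : ∀ x y z w → y * (w * (x * z)) ≡ x * y * (w * z)
  regroup′ = ℕ.solve-∀
  absorb : n * ((n + n) C n) ≡ d * suc n
  absorb = *-cancelʳ-≡ _ _ (n ! * m !) {{n !* m !≢0}} (begin
    n * ((n + n) C n) * (n ! * m !) ≡⟨ regroup′ n ((n + n) C n) (m !) (n !) ⟨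
    ((n + n) C n) * (n ! * n !)     ≡⟨ C-factorial n n ⟩
    (n + n) !                       ≡⟨ cong _! n+n≡ ⟨
    (suc n + m) !                   ≡⟨ C-factorial (suc n) m ⟨
    ((suc n + m) C suc n) * (suc n ! * m !) ≡⟨ cong (λ k → (k C suc n) * (suc n ! * m !)) n+n≡ ⟩
    d * (suc n ! * m !)             ≡⟨ regroup d n (n !) (m !) ⟨
    d * suc n * (n ! * m !)         ∎)
    where
    n+n≡ : suc n + m ≡ n + n
    n+n≡ = cong suc (+-comm n m)

catalan-central : ∀ n → catalan n * suc n ≡ (n + n) C n
catalan-central n = trans (m/n*n≡m (subst (suc n ∣_) 2n (suc∣central n))) (sym 2n)
  where
  2n : (n + n) C n ≡ (2 * n) C n
  2n = cong (λ m → (n + m) C n) (sym (+-identityʳ n))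

central-suc : ∀ n → suc n * ((suc n + suc n) C suc n) ≡ (2 + 4 * n) * ((n + n) C n)
central-suc n = *-cancelʳ-≡ _ _ (suc n ! * n !) {{suc n !* n !≢0}} (begin
  suc n * b′ * (suc n ! * n !)    ≡⟨ regroup n b′ (suc n !) (n !) ⟩
  b′ * (suc n ! * suc n !)        ≡⟨ C-factorial (suc n) (suc n) ⟩
  (suc n + suc n) !               ≡⟨ cong (λ m → suc m !) (+-suc n n) ⟩
  suc (suc (n + n)) * (suc (n + n) * (n + n) !) ≡⟨ cong (λ z → suc (suc (n + n)) * (suc (n + n) * z)) (C-factorial n n) ⟨
  suc (suc (n + n)) * (suc (n + n) * (b * (n ! * n !))) ≡⟨ regroup′ n b (n !) ⟩
  (2 + 4 * n) * b * (suc n ! * n !) ∎)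
  where
  b  = (n + n) C n
  b′ = (suc n + suc n) C suc n
  regroup : ∀ n x y z → (1 + n) * x * (y * z) ≡ x * (y * ((1 + n) * z))
  regroup = ℕ.solve-∀
  regroup′ : ∀ n x y → (2 + (n + n)) * ((1 + (n + n)) * (x * (y * y))) ≡ (2 + 4 * n) * x * ((1 + n) * y * y)
  regroup′ = ℕ.solve-∀

catalan-ratio : ∀ n → (2 + n) * catalan (suc n) ≡ (2 + 4 * n) * catalan n
catalan-ratio n = *-cancelˡ-≡ _ _ (suc n) (begin
  suc n * ((2 + n) * catalan (suc n)) ≡⟨ cong (suc n *_) (trans (*-comm (2 + n) (catalan (suc n))) (catalan-central (suc n))) ⟩
  suc n * ((suc n + suc n) C suc n)   ≡⟨ central-suc n ⟩
  (2 + 4 * n) * ((n + n) C n)         ≡⟨ cong ((2 + 4 * n) *_) (catalan-central n) ⟨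
  (2 + 4 * n) * (catalan n * suc n)   ≡⟨ regroup n (catalan n) ⟩
  suc n * ((2 + 4 * n) * catalan n)   ∎)
  where
  regroup : ∀ n x → (2 + 4 * n) * (x * (1 + n)) ≡ (1 + n) * ((2 + 4 * n) * x)
  regroup = ℕ.solve-∀

catalan-ratioℤ : ∀ n → + (2 + n) ℤ.* + catalan (suc n) ≡ (+ 4 ℤ.* + suc n ℤ.- + 2) ℤ.* + catalan n
catalan-ratioℤ n = begin
  + (2 + n) ℤ.* + catalan (suc n) ≡⟨ ℤ.pos-* (2 + n) (catalan (suc n)) ⟨
  + ((2 + n) * catalan (suc n))  ≡⟨ cong +_ (catalan-ratio n) ⟩
  + ((2 + 4 * n) * catalan n)    ≡⟨ ℤ.pos-* (2 + 4 * n) (catalan n) ⟩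
  + (2 + 4 * n) ℤ.* + catalan n   ≡⟨ cong (ℤ._* + catalan n) (trans (cong (λ z → + 2 ℤ.+ z) (ℤ.pos-* 4 n)) (recentre (+ n))) ⟩
  (+ 4 ℤ.* + suc n ℤ.- + 2) ℤ.* + catalan n ∎
  where
  recentre : ∀ x → + 2 ℤ.+ + 4 ℤ.* x ≡ + 4 ℤ.* (+ 1 ℤ.+ x) ℤ.- + 2
  recentre = solve-∀

module _ (c : ℕ → ℤ) (c-zero : c 0 ≡ 1ℤ)
         (c-ratio : ∀ n → + (2 + n) ℤ.* c (suc n) ≡ (+ 4 ℤ.* + suc n ℤ.- + 2) ℤ.* c n) where

  catalanConv weightedConv : ℕ → ℤ
  catalanConv  n = focusSum (λ a b → c a ℤ.* c b) (suc n)
  weightedConv n = focusSum (λ a b → + suc a ℤ.* (c a ℤ.* c b)) (suc n)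

  -- By symmetry the average of the left index is half the total.
  2*weightedConv : ∀ n → + 2 ℤ.* weightedConv n ≡ + (2 + n) ℤ.* catalanConv n
  2*weightedConv n = begin
    + 2 ℤ.* weightedConv n
      ≡⟨ double (weightedConv n) ⟩
    weightedConv n ℤ.+ weightedConv n
      ≡⟨ cong (λ z → weightedConv n ℤ.+ z) (focusSum-flip (λ a b → + suc a ℤ.* (c a ℤ.* c b)) (suc n)) ⟨
    weightedConv n ℤ.+ focusSum (λ a b → + suc b ℤ.* (c b ℤ.* c a)) (suc n)
      ≡⟨ focusSum-+ (λ a b → + suc a ℤ.* (c a ℤ.* c b)) (λ a b → + suc b ℤ.* (c b ℤ.* c a)) (suc n) ⟨
    focusSum (λ a b → + suc a ℤ.* (c a ℤ.* c b) ℤ.+ + suc b ℤ.* (c b ℤ.* c a)) (suc n)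
      ≡⟨ focusSum-cong (suc n) (λ a b e → trans (combine (+ suc a) (+ suc b) (c a) (c b))
           (cong (λ m → + m ℤ.* (c a ℤ.* c b)) (cong suc (trans (+-suc a b) e)))) ⟩
    focusSum (λ a b → + (2 + n) ℤ.* (c a ℤ.* c b)) (suc n)
      ≡⟨ focusSum-*ˡ (+ (2 + n)) (λ a b → c a ℤ.* c b) (suc n) ⟩
    + (2 + n) ℤ.* catalanConv n ∎
    where
    double : ∀ x → + 2 ℤ.* x ≡ x ℤ.+ x
    double = solve-∀
    combine : ∀ x y c d → x ℤ.* (c ℤ.* d) ℤ.+ y ℤ.* (d ℤ.* c) ≡ (x ℤ.+ y) ℤ.* (c ℤ.* d)
    combine = solve-∀

  weightedConv-suc : ∀ n → weightedConv (suc n) ≡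
    c (suc n) ℤ.+ (+ 4 ℤ.* weightedConv n ℤ.- + 2 ℤ.* catalanConv n)
  weightedConv-suc n = cong₂ ℤ._+_
    (trans (ℤ.*-identityˡ (c 0 ℤ.* c (suc n))) (trans (cong (ℤ._* c (suc n)) c-zero) (ℤ.*-identityˡ (c (suc n)))))
    (begin
    focusSum (λ a b → + (2 + a) ℤ.* (c (suc a) ℤ.* c b)) (suc n)
      ≡⟨ focusSum-cong (suc n) (λ a b _ → trans (sym (ℤ.*-assoc (+ (2 + a)) (c (suc a)) (c b)))
           (trans (cong (ℤ._* c b) (c-ratio a)) (expand (+ suc a) (c a) (c b)))) ⟩
    focusSum (λ a b → + 4 ℤ.* (+ suc a ℤ.* (c a ℤ.* c b)) ℤ.+ (ℤ.- + 2) ℤ.* (c a ℤ.* c b)) (suc n)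
      ≡⟨ focusSum-+ (λ a b → + 4 ℤ.* (+ suc a ℤ.* (c a ℤ.* c b))) (λ a b → (ℤ.- + 2) ℤ.* (c a ℤ.* c b)) (suc n) ⟩
    focusSum (λ a b → + 4 ℤ.* (+ suc a ℤ.* (c a ℤ.* c b))) (suc n) ℤ.+
    focusSum (λ a b → (ℤ.- + 2) ℤ.* (c a ℤ.* c b)) (suc n)
      ≡⟨ cong₂ ℤ._+_ (focusSum-*ˡ (+ 4) (λ a b → + suc a ℤ.* (c a ℤ.* c b)) (suc n))
           (trans (focusSum-*ˡ (ℤ.- + 2) (λ a b → c a ℤ.* c b) (suc n)) (sym (ℤ.neg-distribˡ-* (+ 2) (catalanConv n)))) ⟩
    + 4 ℤ.* weightedConv n ℤ.- + 2 ℤ.* catalanConv n ∎)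
    where
    expand : ∀ x c d → (+ 4 ℤ.* x ℤ.- + 2) ℤ.* c ℤ.* d ≡ + 4 ℤ.* (x ℤ.* (c ℤ.* d)) ℤ.+ (ℤ.- + 2) ℤ.* (c ℤ.* d)
    expand = solve-∀

  segner : ∀ n → catalanConv n ≡ c (suc n)
  segner zero    = first (c 0) (c 1) c-zero (c-ratio 0)
    where
    first : ∀ x y → x ≡ 1ℤ → + 2 ℤ.* y ≡ + 2 ℤ.* x → x ℤ.* x ℤ.+ 0ℤ ≡ y
    first x y refl e = sym (ℤ.*-cancelˡ-≡ (+ 2) y (+ 1) e)
  segner (suc n) = ℤ.*-cancelˡ-≡ (+ (3 + n)) (catalanConv (suc n)) (c (2 + n)) (begin
    + (3 + n) ℤ.* catalanConv (suc n)
      ≡⟨ 2*weightedConv (suc n) ⟨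
    + 2 ℤ.* weightedConv (suc n)
      ≡⟨ cong (+ 2 ℤ.*_) (weightedConv-suc n) ⟩
    + 2 ℤ.* (c′ ℤ.+ (+ 4 ℤ.* weightedConv n ℤ.- + 2 ℤ.* catalanConv n))
      ≡⟨ expand c′ (weightedConv n) (catalanConv n) ⟩
    + 2 ℤ.* c′ ℤ.+ (+ 4 ℤ.* (+ 2 ℤ.* weightedConv n) ℤ.- + 4 ℤ.* catalanConv n)
      ≡⟨ cong₂ (λ w s → + 2 ℤ.* c′ ℤ.+ (+ 4 ℤ.* w ℤ.- + 4 ℤ.* s))
           (trans (2*weightedConv n) (cong (+ (2 + n) ℤ.*_) (segner n))) (segner n) ⟩
    + 2 ℤ.* c′ ℤ.+ (+ 4 ℤ.* (+ (2 + n) ℤ.* c′) ℤ.- + 4 ℤ.* c′)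
      ≡⟨ collect c′ (+ (2 + n)) ⟩
    (+ 4 ℤ.* + (2 + n) ℤ.- + 2) ℤ.* c′
      ≡⟨ c-ratio (suc n) ⟨
    + (3 + n) ℤ.* c (suc (suc n)) ∎)
    where
    c′ = c (suc n)
    expand : ∀ c w s → + 2 ℤ.* (c ℤ.+ (+ 4 ℤ.* w ℤ.- + 2 ℤ.* s)) ≡ + 2 ℤ.* c ℤ.+ (+ 4 ℤ.* (+ 2 ℤ.* w) ℤ.- + 4 ℤ.* s)
    expand = solve-∀
    collect : ∀ c m → + 2 ℤ.* c ℤ.+ (+ 4 ℤ.* (m ℤ.* c) ℤ.- + 4 ℤ.* c) ≡ (+ 4 ℤ.* m ℤ.- + 2) ℤ.* c
    collect = solve-∀

-- Lassalle's recurrence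

-- The coefficients of f(z²).
spread : (ℕ → ℤ) → ℕ → ℤ
spread f zero          = f 0
spread f (suc zero)    = 0ℤ
spread f (suc (suc n)) = spread (λ k → f (suc k)) n

double : ℕ → ℕ
double zero    = zero
double (suc n) = suc (suc (double n))

double≡2* : ∀ n → double n ≡ 2 * n
double≡2* zero    = refl
double≡2* (suc n) = cong suc (trans (cong suc (double≡2* n)) (sym (+-suc n (n + 0))))

spread-double : ∀ f n → spread f (double n) ≡ f n
spread-double f zero    = refl
spread-double f (suc n) = spread-double (λ k → f (suc k)) n

spread-suc-double : ∀ f n → spread f (suc (double n)) ≡ 0ℤ
spread-suc-double f zero    = refl
spread-suc-double f (suc n) = spread-suc-double (λ k → f (suc k)) n

spread-cong : ∀ {f g} n → (∀ k → f k ≡ g k) → spread f n ≡ spread g n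
spread-cong zero          eq = eq 0
spread-cong (suc zero)    eq = refl
spread-cong (suc (suc n)) eq = spread-cong n (λ k → eq (suc k))

spread-+ : ∀ f g n → spread (λ k → f k ℤ.+ g k) n ≡ spread f n ℤ.+ spread g n
spread-+ f g zero          = refl
spread-+ f g (suc zero)    = refl
spread-+ f g (suc (suc n)) = spread-+ (λ k → f (suc k)) (λ k → g (suc k)) n

spread-*ˡ : ∀ c f n → spread (λ k → c ℤ.* f k) n ≡ c ℤ.* spread f n
spread-*ˡ c f zero          = refl
spread-*ˡ c f (suc zero)    = sym (ℤ.*-zeroʳ c)
spread-*ˡ c f (suc (suc n)) = spread-*ˡ c (λ k → f (suc k)) n

spread-conv : ∀ f g n →
  focusSum (λ a b → spread f a ℤ.* spread g b) (suc n) ≡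
  spread (λ m → focusSum (λ a b → f a ℤ.* g b) (suc m)) n
spread-conv f g zero          = refl
spread-conv f g (suc zero)    = cong₂ (λ x y → x ℤ.+ (y ℤ.+ 0ℤ)) (ℤ.*-zeroʳ (f 0)) (ℤ.*-zeroˡ (g 0))
spread-conv f g (suc (suc n)) = begin
  f 0 ℤ.* spread g′ n ℤ.+ (0ℤ ℤ.* spread g (suc n) ℤ.+ focusSum (λ a b → spread f′ a ℤ.* spread g b) (suc n))
    ≡⟨ cong (λ z → f 0 ℤ.* spread g′ n ℤ.+ z) (trans
         (cong₂ ℤ._+_ (ℤ.*-zeroˡ (spread g (suc n))) (spread-conv f′ g n)) (ℤ.+-identityˡ _)) ⟩
  f 0 ℤ.* spread g′ n ℤ.+ spread (λ m → focusSum (λ a b → f′ a ℤ.* g b) (suc m)) n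
    ≡⟨ cong (λ z → z ℤ.+ spread (λ m → focusSum (λ a b → f′ a ℤ.* g b) (suc m)) n) (spread-*ˡ (f 0) g′ n) ⟨
  spread (λ m → f 0 ℤ.* g′ m) n ℤ.+ spread (λ m → focusSum (λ a b → f′ a ℤ.* g b) (suc m)) n
    ≡⟨ spread-+ (λ m → f 0 ℤ.* g′ m) (λ m → focusSum (λ a b → f′ a ℤ.* g b) (suc m)) n ⟨
  spread (λ m → f 0 ℤ.* g′ m ℤ.+ focusSum (λ a b → f′ a ℤ.* g b) (suc m)) n ∎
  where
  f′ g′ : ℕ → ℤ
  f′ k = f (suc k)
  g′ k = g (suc k)

focusSum-even : ∀ F n → (∀ a b → F (suc (double a)) b ≡ 0ℤ) →
  focusSum F (double n) ≡ focusSum (λ a b → F (double a) (suc (double b))) n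
focusSum-even F zero    odd≡0 = refl
focusSum-even F (suc n) odd≡0 = cong (λ z → F 0 (suc (double n)) ℤ.+ z) (trans
  (cong₂ ℤ._+_ (odd≡0 0 (double n)) (focusSum-even (λ a b → F (suc (suc a)) b) n (λ a b → odd≡0 (suc a) b)))
  (ℤ.+-identityˡ _))

signedCatalan : ℕ → ℤ
signedCatalan n = -1ℤ ℤ.^ n ℤ.* + catalan n

signedCatalan-suc : ∀ n → signedCatalan (suc n) ≡
  ℤ.- focusSum (λ a b → signedCatalan a ℤ.* signedCatalan b) (suc n)
signedCatalan-suc n = begin
  -1ℤ ℤ.* -1ℤ ℤ.^ n ℤ.* + catalan (suc n)
    ≡⟨ neg-out (-1ℤ ℤ.^ n) (+ catalan (suc n)) ⟩
  ℤ.- (-1ℤ ℤ.^ n ℤ.* + catalan (suc n))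
    ≡⟨ cong (λ z → ℤ.- (-1ℤ ℤ.^ n ℤ.* z)) (segner (λ k → + catalan k) refl catalan-ratioℤ n) ⟨
  ℤ.- (-1ℤ ℤ.^ n ℤ.* focusSum (λ a b → + catalan a ℤ.* + catalan b) (suc n))
    ≡⟨ cong ℤ.-_ (trans (sym (focusSum-*ˡ (-1ℤ ℤ.^ n) (λ a b → + catalan a ℤ.* + catalan b) (suc n)))
         (focusSum-cong (suc n) λ a b e → trans
           (cong (ℤ._* (+ catalan a ℤ.* + catalan b))
             (trans (cong (-1ℤ ℤ.^_) (sym (suc-injective e))) (ℤ.^-distribˡ-+-* -1ℤ a b)))
           (interchange (-1ℤ ℤ.^ a) (-1ℤ ℤ.^ b) (+ catalan a) (+ catalan b)))) ⟩
  ℤ.- focusSum (λ a b → signedCatalan a ℤ.* signedCatalan b) (suc n) ∎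
  where
  neg-out : ∀ x y → -1ℤ ℤ.* x ℤ.* y ≡ ℤ.- (x ℤ.* y)
  neg-out = solve-∀
  interchange : ∀ x y z w → x ℤ.* y ℤ.* (z ℤ.* w) ≡ x ℤ.* z ℤ.* (y ℤ.* w)
  interchange = solve-∀

-- J₁(2z)/z, as an exponential generating function.
bessel : ℕ → ℤ
bessel = spread signedCatalan

bessel-suc : ∀ n → bessel (suc n) ≡ ℤ.- focusSum (λ a b → bessel a ℤ.* bessel b) n
bessel-suc zero    = refl
bessel-suc (suc n) = begin
  spread (λ k → signedCatalan (suc k)) n
    ≡⟨ spread-cong n (λ k → trans (signedCatalan-suc k) (sym (ℤ.-1*i≡-i _))) ⟩
  spread (λ k → -1ℤ ℤ.* focusSum (λ a b → signedCatalan a ℤ.* signedCatalan b) (suc k)) n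
    ≡⟨ spread-*ˡ -1ℤ (λ k → focusSum (λ a b → signedCatalan a ℤ.* signedCatalan b) (suc k)) n ⟩
  -1ℤ ℤ.* spread (λ k → focusSum (λ a b → signedCatalan a ℤ.* signedCatalan b) (suc k)) n
    ≡⟨ ℤ.-1*i≡-i _ ⟩
  ℤ.- spread (λ k → focusSum (λ a b → signedCatalan a ℤ.* signedCatalan b) (suc k)) n
    ≡⟨ cong ℤ.-_ (spread-conv signedCatalan signedCatalan n) ⟨
  ℤ.- focusSum (λ a b → bessel a ℤ.* bessel b) (suc n) ∎

sum-focusSum : ∀ n {f : ℕ → ℤ} {F} → (∀ a b → suc (a + b) ≡ n → f a ≡ F a b) →
  ∑[ i < n ] f (toℕ i) ≡ focusSum F n
sum-focusSum zero    eq = refl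
sum-focusSum (suc n) eq = cong₂ ℤ._+_ (eq 0 n refl) (sum-focusSum n (λ a b e → eq (suc a) b (cong suc e)))

total : ℕ → ℤ
total = focusSum count

lassalle-focusSum : ∀ n → lassalle (suc n) ≡
  -1ℤ ℤ.^ n ℤ.* + catalan (suc n) ℤ.+
  focusSum (λ i k → -1ℤ ℤ.^ i ℤ.* + ((suc (double k) + double (suc i)) C suc (double k)) ℤ.* lassalle (suc k)
    ℤ.* + catalan (suc i)) n
lassalle-focusSum n = trans (lassalle-rec n) (cong (λ z → -1ℤ ℤ.^ n ℤ.* + catalan (suc n) ℤ.+ z)
  (sum-focusSum n term))
  where
  term : ∀ i k → suc (i + k) ≡ n →
    -1ℤ ℤ.^ i ℤ.* + ((2 * suc n ∸ 1) C (2 * suc n ∸ 2 * suc i ∸ 1)) ℤ.* lassalle (suc n ∸ suc i) ℤ.* + catalan (suc i)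
    ≡ -1ℤ ℤ.^ i ℤ.* + ((suc (double k) + double (suc i)) C suc (double k)) ℤ.* lassalle (suc k) ℤ.* + catalan (suc i)
  term i k refl = cong₂ (λ b l → -1ℤ ℤ.^ i ℤ.* + b ℤ.* l ℤ.* + catalan (suc i))
    (cong₂ _C_ upper lower) (cong lassalle drop)
    where
    drop : suc n ∸ suc i ≡ suc k
    drop = trans (cong (_∸ i) (sym (+-suc i k))) (m+n∸m≡n i (suc k))
    odd : ∀ i k → 1 + 2 * (1 + (i + k)) ≡ (1 + 2 * k) + 2 * (1 + i)
    odd = ℕ.solve-∀
    upper : 2 * suc n ∸ 1 ≡ suc (double k) + double (suc i)
    upper = begin
      2 * suc n ∸ 1                  ≡⟨ cong (_∸ 1) (double≡2* (suc n)) ⟨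
      suc (double n)                 ≡⟨ cong suc (double≡2* n) ⟩
      suc (2 * n)                    ≡⟨ odd i k ⟩
      suc (2 * k) + 2 * suc i        ≡⟨ cong₂ (λ x y → suc x + y) (double≡2* k) (double≡2* (suc i)) ⟨
      suc (double k) + double (suc i) ∎
    lower : 2 * suc n ∸ 2 * suc i ∸ 1 ≡ suc (double k)
    lower = begin
      2 * suc n ∸ 2 * suc i ∸ 1 ≡⟨ cong (_∸ 1) (*-distribˡ-∸ 2 (suc n) (suc i)) ⟨
      2 * (suc n ∸ suc i) ∸ 1   ≡⟨ cong (λ m → 2 * m ∸ 1) drop ⟩
      2 * suc k ∸ 1             ≡⟨ cong (_∸ 1) (double≡2* (suc k)) ⟨
      suc (double k)            ∎

total≡lassalle : ∀ m n → n ≤ m → total (suc (double n)) ≡ lassalle (suc n)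
total≡lassalle m n n≤m = begin
  T                                              ≡⟨ add-cancel T L ⟩
  (T ℤ.+ -1ℤ ℤ.* L) ℤ.+ L                         ≡⟨ cong (ℤ._+ L) recurrence ⟩
  ℤ.- signedCatalan (suc n) ℤ.+ L                ≡⟨ cong (ℤ._+ L) (sign-out (-1ℤ ℤ.^ n) (+ catalan (suc n))) ⟩
  -1ℤ ℤ.^ n ℤ.* + catalan (suc n) ℤ.+ L           ≡⟨ lassalle-focusSum n ⟨
  lassalle (suc n) ∎
  where
  T = total (suc (double n))
  term : ℕ → ℕ → ℤ
  term i k = -1ℤ ℤ.^ i ℤ.* + ((suc (double k) + double (suc i)) C suc (double k)) ℤ.* lassalle (suc k) ℤ.* + catalan (suc i)
  L = focusSum term n
  G : ℕ → ℕ → ℤ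
  G b a = + ((a + b) C a) ℤ.* (total a ℤ.* bessel b)
  add-cancel : ∀ x y → x ≡ (x ℤ.+ -1ℤ ℤ.* y) ℤ.+ y
  add-cancel = solve-∀
  sign-out : ∀ x y → ℤ.- (-1ℤ ℤ.* x ℤ.* y) ≡ x ℤ.* y
  sign-out = solve-∀
  vanish : ∀ x y → x ℤ.* (y ℤ.* 0ℤ) ≡ 0ℤ
  vanish = solve-∀
  reorder : ∀ b l x c → b ℤ.* (l ℤ.* (-1ℤ ℤ.* x ℤ.* c)) ≡ -1ℤ ℤ.* (x ℤ.* b ℤ.* l ℤ.* c)
  reorder = solve-∀
  first : T ≡ G 0 (suc (double n))
  first = sym (trans (cong (λ b → + b ℤ.* (T ℤ.* 1ℤ))
      (trans (cong (_C suc (double n)) (+-identityʳ (suc (double n)))) (nCn≡1 (suc (double n)))))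
    (trans (ℤ.*-identityˡ (T ℤ.* 1ℤ)) (ℤ.*-identityʳ T)))
  later : ∀ m i k → suc (i + k) ≡ n → n ≤ m → -1ℤ ℤ.* term i k ≡ G (double (suc i)) (suc (double k))
  later (suc m) i k refl (s≤s l) = sym (trans
    (cong₂ (λ t j → + ((suc (double k) + double (suc i)) C suc (double k)) ℤ.* (t ℤ.* j))
      (total≡lassalle m k (≤-trans (m≤n+m k i) l)) (spread-double signedCatalan (suc i)))
    (reorder (+ ((suc (double k) + double (suc i)) C suc (double k))) (lassalle (suc k)) (-1ℤ ℤ.^ i) (+ catalan (suc i))))
  recurrence : T ℤ.+ -1ℤ ℤ.* L ≡ ℤ.- signedCatalan (suc n)
  recurrence = begin
    T ℤ.+ -1ℤ ℤ.* L
      ≡⟨ cong₂ ℤ._+_ first (trans (sym (focusSum-*ˡ -1ℤ term n)) (focusSum-cong n (λ i k e → later m i k e n≤m))) ⟩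
    focusSum (λ i k → G (double i) (suc (double k))) (suc n)
      ≡⟨ focusSum-even G (suc n) (λ i k → trans
           (cong (λ j → + ((k + suc (double i)) C k) ℤ.* (total k ℤ.* j)) (spread-suc-double signedCatalan i))
           (vanish (+ ((k + suc (double i)) C k)) (total k))) ⟨
    focusSum G (double (suc n))
      ≡⟨ focusSum-flip G (double (suc n)) ⟨
    focusSum (λ a b → G b a) (double (suc n))
      ≡⟨ splitSum-binomial (λ a b → total a ℤ.* bessel b) (suc (double n)) ⟨
    splitSum (λ a b → total a ℤ.* bessel b) (suc (double n))
      ≡⟨ total-recurrence bessel refl bessel-suc (suc (double n)) ⟩
    ℤ.- bessel (double (suc n))
      ≡⟨ cong ℤ.-_ (spread-double signedCatalan (suc n)) ⟩
    ℤ.- signedCatalan (suc n) ∎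

-- Lonely trees

root : LabeledTree → ℕ
root (leaf _)     = 0
root (node _ x _) = x

first : LabeledTree → ℕ
first (leaf _)                          = 0
first (node (leaf _)       x (leaf _))  = x
first (node (leaf _)       x r@(node _ _ _)) = first r
first (node l@(node _ _ _) x r)         = first l

data Good : LabeledTree → Set where
  vertex : ∀ {x} → Good (node (leaf tt) x (leaf tt))
  branch : ∀ {l x r} → Good l → Good r → first r < root l → root l < x → root r < x →
           Good (node l x r)

first-branch : ∀ {l x r} → Good l → first (node l x r) ≡ first l
first-branch vertex             = refl
first-branch (branch _ _ _ _ _) = refl

good⇒below : ∀ {t x} → Good t → root t < x → RootBelow x t
good⇒below vertex             t<x = node t<x
good⇒below (branch _ _ _ _ _) t<x = node t<x

good⇒decreasing : ∀ {t} → Good t → Decreasing t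
good⇒decreasing vertex                 = node leaf leaf leaf leaf
good⇒decreasing (branch gl gr _ l<x r<x) =
  node (good⇒below gl l<x) (good⇒below gr r<x) (good⇒decreasing gl) (good⇒decreasing gr)

descent : ℕ → ℕ → ℕ
descent a b with b <? a
... | yes _ = 1
... | no  _ = 0

descent-yes : ∀ {a b} → b < a → descent a b ≡ 1
descent-yes {a} {b} b<a with b <? a
... | yes _   = refl
... | no  b≮a = contradiction b<a b≮a

descent-no : ∀ {a b} → a < b → descent a b ≡ 0
descent-no {a} {b} a<b with b <? a
... | yes b<a = contradiction b<a (<-asym a<b)
... | no  _   = refl

descentsFrom : ℕ → List ℕ → ℕ
descentsFrom a []      = 0
descentsFrom a (b ∷ w) = descent a b + descentsFrom b w

descents : LabeledTree → ℕ
descents (leaf _)                      = 0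
descents (node (leaf _) x r)           = descents r
descents (node l@(node _ _ _) x (leaf _)) = descents l
descents (node l@(node _ _ _) x r@(node _ _ _)) = descents l + (descent (root l) (first r) + descents r)

descentsFrom-postorder : ∀ {l x r} (let t = node l x r) a w → Decreasing t →
  descentsFrom a (Suffix.toDiffList t w) ≡ descent a (first t) + (descents t + descentsFrom x w)
descentsFrom-postorder {leaf _} {x} {leaf _} a w _ = refl
descentsFrom-postorder {leaf _} {x} {node _ y _} a w (node _ (node y<x) _ dr)
  rewrite descentsFrom-postorder a (x ∷ w) dr | descent-no y<x = refl
descentsFrom-postorder {node _ y _} {x} {leaf _} a w (node (node y<x) _ dl _)
  rewrite descentsFrom-postorder a (x ∷ w) dl | descent-no y<x = refl
descentsFrom-postorder {l@(node _ y _)} {x} {r@(node _ z _)} a w (node (node y<x) (node z<x) dl dr)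
  rewrite descentsFrom-postorder a (Suffix.toDiffList r (x ∷ w)) dl
        | descentsFrom-postorder y (x ∷ w) dr | descent-no z<x =
  cong (λ m → descent a (first l) + m) (trans
    (cong (λ m → descents l + m) (sym (+-assoc (descent y (first r)) (descents r) (descentsFrom x w))))
    (sym (+-assoc (descents l) _ _)))

descents-postorder : ∀ {t} → Decreasing t → descents t ≡ descentsFrom 0 (postorder t)
descents-postorder leaf             = refl
descents-postorder d@(node _ _ _ _) = sym (trans (descentsFrom-postorder 0 [] d) (+-identityʳ _))

length-postorder : ∀ t → length (postorder t) ≡ #nodes t
length-postorder t = trans (length-toDiffList t []) (+-identityʳ (#nodes t))
  where
  length-toDiffList : ∀ (t : LabeledTree) w → length (Suffix.toDiffList t w) ≡ #nodes t + length w
  length-toDiffList (leaf _)     w = refl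
  length-toDiffList (node l x r) w = begin
    length (Suffix.toDiffList l (Suffix.toDiffList r (x ∷ w))) ≡⟨ length-toDiffList l _ ⟩
    #nodes l + length (Suffix.toDiffList r (x ∷ w))            ≡⟨ cong (λ m → #nodes l + m) (length-toDiffList r (x ∷ w)) ⟩
    #nodes l + (#nodes r + suc (length w))                     ≡⟨ cong (λ m → #nodes l + m) (+-suc (#nodes r) (length w)) ⟩
    #nodes l + suc (#nodes r + length w)                       ≡⟨ +-assoc (#nodes l) (suc (#nodes r)) (length w) ⟨
    #nodes l + suc (#nodes r) + length w                       ∎

good-#nodes : ∀ {t} → Good t → #nodes t ≡ suc (descents t + descents t)
good-#nodes vertex = refl
good-#nodes (branch {l} {x} {r} gl gr r<l _ _) = begin
  #nodes l + suc (#nodes r)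
    ≡⟨ cong₂ (λ m n → m + suc n) (good-#nodes gl) (good-#nodes gr) ⟩
  suc (dl + dl) + suc (suc (dr + dr))
    ≡⟨ regroup dl dr ⟩
  suc ((dl + (1 + dr)) + (dl + (1 + dr)))
    ≡⟨ cong (λ d → suc (d + d)) (descents-branch gl gr) ⟨
  suc (descents (node l x r) + descents (node l x r)) ∎
  where
  dl = descents l
  dr = descents r
  regroup : ∀ m n → suc (m + m) + suc (suc (n + n)) ≡ suc ((m + (1 + n)) + (m + (1 + n)))
  regroup = ℕ.solve-∀
  descents-branch : Good l → Good r → descents (node l x r) ≡ dl + (1 + dr)
  descents-branch vertex             vertex             rewrite descent-yes r<l = refl
  descents-branch vertex             (branch _ _ _ _ _) rewrite descent-yes r<l = refl
  descents-branch (branch _ _ _ _ _) vertex             rewrite descent-yes r<l = refl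
  descents-branch (branch _ _ _ _ _) (branch _ _ _ _ _) rewrite descent-yes r<l = refl

#nodes-bound : ∀ {l x r} (let t = node l x r) → Decreasing t → suc (descents t + descents t) ≤ #nodes t
#nodes-bound {leaf _} {x} {leaf _} _ = ≤-refl
#nodes-bound {leaf _} {x} {node _ _ _} (node _ _ _ dr) = m≤n⇒m≤1+n (#nodes-bound dr)
#nodes-bound {l@(node _ _ _)} {x} {leaf _} (node _ _ dl _) = ≤-trans (#nodes-bound dl) (m≤m+n (#nodes l) 1)
#nodes-bound {l@(node _ y _)} {x} {r@(node _ _ _)} (node _ _ dl dr) with first r <? y
... | yes _ = ≤-trans (≤-reflexive (regroup (descents l) (descents r)))
                (+-mono-≤ (#nodes-bound dl) (s≤s (#nodes-bound dr)))
  where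
  regroup : ∀ m n → suc ((m + (1 + n)) + (m + (1 + n))) ≡ suc (m + m) + suc (suc (n + n))
  regroup = ℕ.solve-∀
... | no  _ = ≤-trans (≤-trans (m≤n+m _ 2) (≤-reflexive (regroup (descents l) (descents r))))
                (+-mono-≤ (#nodes-bound dl) (s≤s (#nodes-bound dr)))
  where
  regroup : ∀ m n → 2 + suc ((m + (0 + n)) + (m + (0 + n))) ≡ suc (m + m) + suc (suc (n + n))
  regroup = ℕ.solve-∀

+-cancel-tight : ∀ {a b} c d → a ≤ c → b ≤ d → c + d ≤ a + b → c ≤ a × d ≤ b
+-cancel-tight {a} {b} c d a≤c b≤d le =
  +-cancelʳ-≤ d c a (≤-trans le (+-monoʳ-≤ a b≤d)) ,
  +-cancelˡ-≤ c d b (≤-trans le (+-monoˡ-≤ b a≤c))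

tight⇒good : ∀ {l x r} (let t = node l x r) → Decreasing t →
  #nodes t ≤ suc (descents t + descents t) → Good t
tight⇒good {leaf _} {x} {leaf _} _ _ = vertex
tight⇒good {leaf _} {x} {node _ _ _} (node _ _ _ dr) le = contradiction le (<⇒≱ (s≤s (#nodes-bound dr)))
tight⇒good {l@(node _ _ _)} {x} {leaf _} (node _ _ dl _) le =
  contradiction le (<⇒≱ (≤-trans (s≤s (#nodes-bound dl)) (≤-reflexive (+-comm 1 (#nodes l)))))
tight⇒good {l@(node _ y _)} {x} {r@(node _ z _)} (node (node y<x) (node z<x) dl dr) le with first r <? y
... | yes r<l = branch (tight⇒good dl (proj₁ tight)) (tight⇒good dr (proj₂ tight)) r<l y<x z<x
  where
  regroup : ∀ m n → suc ((m + (1 + n)) + (m + (1 + n))) ≡ suc (suc (m + m) + suc (n + n))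
  regroup = ℕ.solve-∀
  tight = +-cancel-tight (#nodes l) (#nodes r) (#nodes-bound dl) (#nodes-bound dr)
    (s≤s⁻¹ (subst₂ _≤_ (+-suc (#nodes l) (#nodes r)) (regroup (descents l) (descents r)) le))
... | no  r≮l = contradiction (≤-trans (+-mono-≤ (#nodes-bound dl) (s≤s (#nodes-bound dr))) le)
    (<⇒≱ (≤-trans (n≤1+n _) (≤-reflexive (regroup (descents l) (descents r)))))
  where
  regroup : ∀ m n → 2 + suc ((m + (0 + n)) + (m + (0 + n))) ≡ suc (m + m) + suc (suc (n + n))
  regroup = ℕ.solve-∀

-- A stack machine inverting the postorder on good trees: a letter is a leaf
-- exactly when it is the first letter or a descent bottom.

reduce : List LabeledTree → ℕ → List LabeledTree
reduce []           a = node (leaf tt) a (leaf tt) ∷ []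
reduce (s ∷ [])     a = node (leaf tt) a (leaf tt) ∷ s ∷ []
reduce (r ∷ l ∷ st) a with a <? root r
... | yes _ = node (leaf tt) a (leaf tt) ∷ r ∷ l ∷ st
... | no  _ = node l a r ∷ st

Drops : List LabeledTree → ℕ → Set
Drops []       a = ⊤
Drops (s ∷ st) a = a < root s

reduce-leaf : ∀ st {a} → Drops st a → reduce st a ≡ node (leaf tt) a (leaf tt) ∷ st
reduce-leaf []           _ = refl
reduce-leaf (s ∷ [])     _ = refl
reduce-leaf (r ∷ l ∷ st) {a} a<r with a <? root r
... | yes _   = refl
... | no  a≮r = contradiction a<r a≮r

reduce-branch : ∀ l r st {a} → root r < a → reduce (r ∷ l ∷ st) a ≡ node l a r ∷ st
reduce-branch l r st {a} r<a with a <? root r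
... | yes a<r = contradiction a<r (<-asym r<a)
... | no  _   = refl

foldl-reduce : ∀ {t} → Good t → ∀ st w → Drops st (first t) →
  foldl reduce st (Suffix.toDiffList t w) ≡ foldl reduce (t ∷ st) w
foldl-reduce vertex st w dr = cong (λ s → foldl reduce s w) (reduce-leaf st dr)
foldl-reduce (branch {l} {x} {r} gl gr r<l l<x r<x) st w dr = begin
  foldl reduce st (Suffix.toDiffList l (Suffix.toDiffList r (x ∷ w)))
    ≡⟨ foldl-reduce gl st _ (subst (Drops st) (first-branch gl) dr) ⟩
  foldl reduce (l ∷ st) (Suffix.toDiffList r (x ∷ w))
    ≡⟨ foldl-reduce gr (l ∷ st) (x ∷ w) r<l ⟩
  foldl reduce (reduce (r ∷ l ∷ st) x) w
    ≡⟨ cong (λ s → foldl reduce s w) (reduce-branch l r st r<x) ⟩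
  foldl reduce (node l x r ∷ st) w ∎

good-injective : ∀ {t t′} → Good t → Good t′ → postorder t ≡ postorder t′ → t ≡ t′
good-injective gt gt′ eq = ∷-injectiveˡ (trans (sym (foldl-reduce gt [] [] tt))
  (trans (cong (foldl reduce []) eq) (foldl-reduce gt′ [] [] tt)))

good⇒lonely : ∀ {t} → Good t → Lonely t
good⇒lonely {t} gt t′ isTree eq = unique t′ nonEmpty decreasing eq
  where
  open IsDecreasingBinaryPlaneTree isTree
  unique : ∀ t′ → 0 < #nodes t′ → Decreasing t′ → postorder t′ ≡ postorder t → t′ ≡ t
  unique t′@(node _ _ _) _ d eq = good-injective (tight⇒good d (≤-reflexive (begin
    #nodes t′                         ≡⟨ length-postorder t′ ⟨
    length (postorder t′)             ≡⟨ cong length eq ⟩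
    length (postorder t)              ≡⟨ length-postorder t ⟩
    #nodes t                          ≡⟨ good-#nodes gt ⟩
    suc (descents t + descents t)     ≡⟨ cong (λ n → suc (n + n)) same ⟩
    suc (descents t′ + descents t′)   ∎))) gt eq
    where
    same : descents t ≡ descents t′
    same = trans (descents-postorder (good⇒decreasing gt))
      (trans (cong (descentsFrom 0) (sym eq)) (sym (descents-postorder d)))

∈-node⁻ : ∀ l x r {z} → z ∈ postorder (node l x r) → z ∈ postorder l ⊎ z ∈ postorder r ⊎ z ≡ x
∈-node⁻ l x r z∈ rewrite postorder-node l x r with ∈-++⁻ (postorder l) z∈
... | inj₁ z∈l = inj₁ z∈l
... | inj₂ z∈rx with ∈-++⁻ (postorder r) z∈rx
...   | inj₁ z∈r        = inj₂ (inj₁ z∈r)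
...   | inj₂ (here z≡x) = inj₂ (inj₂ z≡x)

∈-nodeˡ : ∀ l x r {z} → z ∈ postorder l → z ∈ postorder (node l x r)
∈-nodeˡ l x r z∈ rewrite postorder-node l x r = ∈-++⁺ˡ z∈

root∈ : ∀ l x r → x ∈ postorder (node l x r)
root∈ l x r rewrite postorder-node l x r = ∈-++⁺ʳ (postorder l) (∈-++⁺ʳ (postorder r) (here refl))

good-root∈ : ∀ {t} → Good t → root t ∈ postorder t
good-root∈ {node l x r} _ = root∈ l x r

good-first∈ : ∀ {t} → Good t → first t ∈ postorder t
good-first∈ vertex                             = here refl
good-first∈ (branch {l} {x} {r} gl _ _ _ _) =
  subst (_∈ postorder (node l x r)) (sym (first-branch gl)) (∈-nodeˡ l x r (good-first∈ gl))

decreasing-below : ∀ {t x z} → Decreasing t → RootBelow x t → z ∈ postorder t → z < x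
decreasing-below {node l y r} (node l<y r<y dl dr) (node y<x) z∈ with ∈-node⁻ l y r z∈
... | inj₁ z∈l         = <-trans (decreasing-below dl l<y z∈l) y<x
... | inj₂ (inj₁ z∈r)  = <-trans (decreasing-below dr r<y z∈r) y<x
... | inj₂ (inj₂ refl) = y<x

unique-++⁻ : ∀ {A : Set} (xs : List A) {ys} → Unique (xs ++ ys) → Unique xs × Unique ys × Disjoint xs ys
unique-++⁻ []       u        = [] , u , λ ()
unique-++⁻ (x ∷ xs) (x∉ ∷ u) =
  let (ux , uy , dis) = unique-++⁻ xs u in
  All.++⁻ˡ xs x∉ ∷ ux , uy , λ where
    (here refl , z∈ys)  → All.lookup (All.++⁻ʳ xs x∉) z∈ys refl
    (there z∈xs , z∈ys) → dis (z∈xs , z∈ys)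

unique-node⁻ : ∀ l x r → Unique (postorder (node l x r)) →
  Unique (postorder l) × Unique (postorder r) × Disjoint (postorder l) (postorder r)
unique-node⁻ l x r u rewrite postorder-node l x r =
  let (ul , urx , dis) = unique-++⁻ (postorder l) u
      (ur , _)         = unique-++⁻ (postorder r) urx
  in ul , ur , λ (z∈l , z∈r) → dis (z∈l , ∈-++⁺ˡ z∈r)

graft : LabeledTree → LabeledTree → LabeledTree
graft s (leaf _)     = s
graft s (node l x r) = node (graft s l) x r

toDiffList-graft : ∀ s t w → Suffix.toDiffList (graft s t) w ≡ Suffix.toDiffList s (Suffix.toDiffList t w)
toDiffList-graft s (leaf _)     w = refl
toDiffList-graft s (node l x r) w = toDiffList-graft s l _

graft-below : ∀ {s t x} → Good t → root t < x → RootBelow x (graft s t)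
graft-below vertex             t<x = node t<x
graft-below (branch _ _ _ _ _) t<x = node t<x

graft-decreasing : ∀ {s t} → Decreasing s → Good t → RootBelow (first t) s → Decreasing (graft s t)
graft-decreasing ds vertex                      s<t = node s<t leaf ds leaf
graft-decreasing ds (branch gl gr _ l<x r<x) s<t = node (graft-below gl l<x) (good⇒below gr r<x)
  (graft-decreasing ds gl (subst (λ a → RootBelow a _) (first-branch gl) s<t)) (good⇒decreasing gr)

Determined : LabeledTree → Set
Determined t = ∀ t′ → Decreasing t′ → postorder t′ ≡ postorder t → t′ ≡ t

lonely⇒determined : ∀ {t} → IsDecreasingBinaryPlaneTree t → Lonely t → Determined t
lonely⇒determined {t} isTree lonely t′ d eq = lonely t′ (record
  { nonEmpty   = subst (0 <_) (trans (sym (length-postorder t)) (trans (cong length (sym eq)) (length-postorder t′))) nonEmpty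
  ; positive   = subst (All (0 <_)) (sym eq) positive
  ; distinct   = subst Unique (sym eq) distinct
  ; decreasing = d }) eq
  where open IsDecreasingBinaryPlaneTree isTree

below-postorder : ∀ {t t′ x} → postorder t′ ≡ postorder t → Decreasing t → RootBelow x t → RootBelow x t′
below-postorder {t′ = leaf _}     eq d t<x = leaf
below-postorder {t′ = node l y r} eq d t<x = node (decreasing-below d t<x (subst (y ∈_) eq (root∈ l y r)))

determinedˡ : ∀ {l x r} → Decreasing (node l x r) → Determined (node l x r) → Determined l
determinedˡ {l} {x} {r} (node l<x r<x dl dr) det l′ dl′ eq = left (det (node l′ x r)
  (node (below-postorder eq dl l<x) r<x dl′ dr)
  (trans (postorder-node l′ x r) (trans (cong (_++ postorder r ++ [ x ]) eq) (sym (postorder-node l x r)))))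
  where
  left : node l′ x r ≡ node l x r → l′ ≡ l
  left refl = refl

determinedʳ : ∀ {l x r} → Decreasing (node l x r) → Determined (node l x r) → Determined r
determinedʳ {l} {x} {r} (node l<x r<x dl dr) det r′ dr′ eq = right (det (node l x r′)
  (node l<x (below-postorder eq dr r<x) dl dr′)
  (trans (postorder-node l x r′) (trans (cong (λ w → postorder l ++ w ++ [ x ]) eq) (sym (postorder-node l x r)))))
  where
  right : node l x r′ ≡ node l x r → r′ ≡ r
  right refl = refl

determined⇒good : ∀ {l x r} (let t = node l x r) → Decreasing t → Unique (postorder t) → Determined t → Good t
determined⇒good {leaf _} {x} {leaf _} d u det = vertex
determined⇒good {leaf _} {x} {r@(node _ _ _)} (node _ r<x _ dr) u det
  with () ← det (node r x (leaf tt)) (node r<x leaf dr leaf) refl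
determined⇒good {l@(node _ _ _)} {x} {leaf _} (node l<x _ dl _) u det
  with () ← det (node (leaf tt) x l) (node leaf l<x leaf dl) refl
determined⇒good {l@(node _ y _)} {x} {r@(node _ z _)} d@(node (node y<x) (node z<x) dl dr) u det
  with unique-node⁻ l x r u
... | ul , ur , dis
  with determined⇒good dl ul (determinedˡ d det) | determined⇒good dr ur (determinedʳ d det)
...   | gl | gr with <-cmp (first r) y
...     | tri< r<l _ _ = branch gl gr r<l y<x z<x
...     | tri≈ _ refl _ = contradiction (good-root∈ gl , good-first∈ gr) dis
...     | tri> _ _ l<r
          with () ← det (node (leaf tt) x (graft l r))
                 (node leaf (graft-below gr z<x) leaf (graft-decreasing dl gr (node l<r)))
                 (toDiffList-graft l r (x ∷ []))

-- Enumeration of good trees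

splits : ∀ {A : Set} → List A → List (List A × List A)
splits []       = [ [] , [] ]
splits (x ∷ xs) = map (map₁ (x ∷_)) (splits xs) ++ map (map₂ (x ∷_)) (splits xs)

foci : ∀ {A : Set} → List A → List (List A × A × List A)
foci []       = []
foci (x ∷ xs) = ([] , x , xs) ∷ map (map₁ (x ∷_)) (foci xs)

∈-splits⁻ : ∀ {A : Set} (xs : List A) {s} → s ∈ splits xs → Interleaving (proj₁ s) (proj₂ s) xs
∈-splits⁻ []       (here refl) = []
∈-splits⁻ (x ∷ xs) s∈ with ∈-++⁻ (map (map₁ (x ∷_)) (splits xs)) s∈
... | inj₁ s∈ˡ with _ , s∈ , refl ← ∈-map⁻ (map₁ (x ∷_)) s∈ˡ = consˡ (∈-splits⁻ xs s∈)
... | inj₂ s∈ʳ with _ , s∈ , refl ← ∈-map⁻ (map₂ (x ∷_)) s∈ʳ = consʳ (∈-splits⁻ xs s∈)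

∈-splits⁺ : ∀ {A : Set} {as bs xs : List A} → Interleaving as bs xs → (as , bs) ∈ splits xs
∈-splits⁺ []                = here refl
∈-splits⁺ {xs = x ∷ xs} (consˡ i) = ∈-++⁺ˡ (∈-map⁺ (map₁ (x ∷_)) (∈-splits⁺ i))
∈-splits⁺ {xs = x ∷ xs} (consʳ i) = ∈-++⁺ʳ (map (map₁ (x ∷_)) (splits xs)) (∈-map⁺ (map₂ (x ∷_)) (∈-splits⁺ i))

∈-foci⁻ : ∀ {A : Set} (xs : List A) {as u bs} → (as , u , bs) ∈ foci xs → as ++ u ∷ bs ≡ xs
∈-foci⁻ (x ∷ xs) (here refl) = refl
∈-foci⁻ (x ∷ xs) (there s∈) with _ , s∈ , refl ← ∈-map⁻ (map₁ (x ∷_)) s∈ = cong (x ∷_) (∈-foci⁻ xs s∈)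

∈-foci⁺ : ∀ {A : Set} (as : List A) {u bs} → (as , u , bs) ∈ foci (as ++ u ∷ bs)
∈-foci⁺ []       = here refl
∈-foci⁺ (a ∷ as) = there (∈-map⁺ (map₁ (a ∷_)) (∈-foci⁺ as))

interleaving-∈ˡ : ∀ {A : Set} {as bs xs : List A} {z} → Interleaving as bs xs → z ∈ as → z ∈ xs
interleaving-∈ˡ i z∈ = ∈-resp-↭ (↭-sym (toPermutation i)) (∈-++⁺ˡ z∈)

interleaving-∈ʳ : ∀ {A : Set} {as bs xs : List A} {z} → Interleaving as bs xs → z ∈ bs → z ∈ xs
interleaving-∈ʳ {as = as} i z∈ = ∈-resp-↭ (↭-sym (toPermutation i)) (∈-++⁺ʳ as z∈)

unique-splits : ∀ {A : Set} {xs : List A} → Unique xs → Unique (splits xs)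
unique-splits {xs = []}     []        = [] ∷ []
unique-splits {xs = x ∷ xs} (x∉ ∷ xs!) = Unique.++⁺
  (Unique.map⁺ (λ { refl → refl }) (unique-splits xs!))
  (Unique.map⁺ (λ { refl → refl }) (unique-splits xs!))
  disjoint
  where
  disjoint : Disjoint (map (map₁ (x ∷_)) (splits xs)) (map (map₂ (x ∷_)) (splits xs))
  disjoint (s∈ˡ , s∈ʳ)
    with _ , t∈ , refl ← ∈-map⁻ (map₁ (x ∷_)) s∈ˡ
    with _ , u∈ , eq ← ∈-map⁻ (map₂ (x ∷_)) s∈ʳ
    = All.lookup x∉ (interleaving-∈ˡ (∈-splits⁻ xs u∈) (subst (x ∈_) (,-injectiveˡ eq) (here refl))) refl

unique-foci : ∀ {A : Set} (xs : List A) → Unique (foci xs)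
unique-foci []       = []
unique-foci (x ∷ xs) = All.map⁺ (All.universal (λ _ ()) (foci xs)) ∷ Unique.map⁺ (λ { refl → refl }) (unique-foci xs)

focus-injective : ∀ {A : Set} {as as′ bs bs′ : List A} {u} → Unique (as ++ u ∷ bs) →
  as ++ u ∷ bs ≡ as′ ++ u ∷ bs′ → (as , u , bs) ≡ (as′ , u , bs′)
focus-injective {as = []}     {[]}      _        refl = refl
focus-injective {as = []}     {a ∷ as′} (u∉ ∷ _) refl = contradiction refl (All.lookup u∉ (∈-++⁺ʳ as′ (here refl)))
focus-injective {as = a ∷ as} {[]}      (a∉ ∷ _) refl = contradiction refl (All.lookup a∉ (∈-++⁺ʳ as (here refl)))
focus-injective {as = a ∷ as} {a′ ∷ as′} (_ ∷ u) eq with refl , eq′ ← ∷-injective eq =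
  cong (map₁ (a ∷_)) (focus-injective u eq′)

interleaving-determined : ∀ {A : Set} {as bs as′ bs′ xs : List A} →
  Interleaving as bs xs → Interleaving as′ bs′ xs → Disjoint as bs′ → Disjoint as′ bs →
  (as , bs) ≡ (as′ , bs′)
interleaving-determined []        []        _ _ = refl
interleaving-determined (consˡ i) (consˡ j) d e = cong (map₁ (_ ∷_))
  (interleaving-determined i j (λ (a , b) → d (there a , b)) (λ (a , b) → e (there a , b)))
interleaving-determined (consˡ i) (consʳ j) d e = contradiction (here refl , here refl) d
interleaving-determined (consʳ i) (consˡ j) d e = contradiction (here refl , here refl) e
interleaving-determined (consʳ i) (consʳ j) d e = cong (map₂ (_ ∷_))
  (interleaving-determined i j (λ (a , b) → d (a , there b)) (λ (a , b) → e (a , there b)))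

unique-concatMap : ∀ {A B : Set} (h : A → List B) {xs} → Unique xs →
  (∀ {x} → x ∈ xs → Unique (h x)) →
  (∀ {x y z} → x ∈ xs → y ∈ xs → z ∈ h x → z ∈ h y → x ≡ y) → Unique (concatMap h xs)
unique-concatMap h {[]}     _          _  _   = []
unique-concatMap h {x ∷ xs} (x∉ ∷ xs!) uh key = Unique.++⁺ (uh (here refl))
  (unique-concatMap h xs! (uh ∘ there) (λ x∈ y∈ → key (there x∈) (there y∈)))
  λ (z∈hx , z∈) → let (y , y∈ , z∈hy) = find (∈-concatMap⁻ h z∈) in
    All.lookup x∉ y∈ (key (here refl) (there y∈) z∈hx z∈hy)

unique-resp-↭ : ∀ {A : Set} {xs ys : List A} → xs ↭ ys → Unique xs → Unique ys
unique-resp-↭ p = ↭ₛ.Unique-resp-↭ (setoid _) (↭⇒↭ₛ p)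

↭-interleaving : ∀ {A : Set} (us vs ws : List A) → us ++ vs ↭ ws →
  ∃₂ λ as bs → Interleaving as bs ws × us ↭ as × vs ↭ bs
↭-interleaving us vs [] p with eq ← ↭-empty-inv p
  rewrite ++-conicalˡ us vs eq | ++-conicalʳ us vs eq = [] , [] , [] , ↭-refl , ↭-refl
↭-interleaving us vs (w ∷ ws) p with ∈-++⁻ us (∈-resp-↭ (↭-sym p) (here refl))
... | inj₁ w∈us
  with us₁ , us₂ , refl ← ∈-∃++ w∈us
  with as , bs , i , us↭ , vs↭ ← ↭-interleaving (us₁ ++ us₂) vs ws
         (↭-trans (↭-reflexive (++-assoc us₁ us₂ vs)) (drop-mid us₁ [] (subst (_↭ w ∷ ws) (++-assoc us₁ (w ∷ us₂) vs) p)))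
  = w ∷ as , bs , consˡ i , ↭-trans (shift w us₁ us₂) (prep w us↭) , vs↭
... | inj₂ w∈vs
  with vs₁ , vs₂ , refl ← ∈-∃++ w∈vs
  with as , bs , i , us↭ , vs↭ ← ↭-interleaving us (vs₁ ++ vs₂) ws
         (↭-trans (↭-reflexive (sym (++-assoc us vs₁ vs₂))) (drop-mid (us ++ vs₁) [] (subst (_↭ w ∷ ws) (sym (++-assoc us vs₁ (w ∷ vs₂))) p)))
  = as , w ∷ bs , consʳ i , us↭ , ↭-trans (shift w vs₁ vs₂) (prep w vs↭)

interleaving-focus⁻ : ∀ {A : Set} (ys : List A) {f xs as bs} → Interleaving as bs (ys ++ f ∷ xs) → ¬ f ∈ bs →
  ∃₂ λ ys₁ ys₂ → ∃₂ λ xs₁ xs₂ →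
    as ≡ ys₁ ++ f ∷ xs₁ × bs ≡ ys₂ ++ xs₂ × Interleaving ys₁ ys₂ ys × Interleaving xs₁ xs₂ xs
interleaving-focus⁻ []       (consˡ i) f∉ = _ , _ , _ , _ , refl , refl , [] , i
interleaving-focus⁻ []       (consʳ i) f∉ = contradiction (here refl) f∉
interleaving-focus⁻ (y ∷ ys) (consˡ i) f∉
  with ys₁ , ys₂ , xs₁ , xs₂ , refl , refl , j , k ← interleaving-focus⁻ ys i f∉
  = y ∷ ys₁ , ys₂ , xs₁ , xs₂ , refl , refl , consˡ j , k
interleaving-focus⁻ (y ∷ ys) (consʳ i) f∉
  with ys₁ , ys₂ , xs₁ , xs₂ , refl , refl , j , k ← interleaving-focus⁻ ys i (f∉ ∘ there)
  = ys₁ , y ∷ ys₂ , xs₁ , xs₂ , refl , refl , consʳ j , k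

Descending : List ℕ → Set
Descending = AllPairs _>_

interleaving-descending : ∀ {as bs xs} → Interleaving as bs xs → Descending xs → Descending as × Descending bs
interleaving-descending []        _        = [] , []
interleaving-descending (consˡ i) (x> ∷ d) = let (da , db) = interleaving-descending i d in
  All.tabulate (λ z∈ → All.lookup x> (interleaving-∈ˡ i z∈)) ∷ da , db
interleaving-descending (consʳ i) (x> ∷ d) = let (da , db) = interleaving-descending i d in
  da , All.tabulate (λ z∈ → All.lookup x> (interleaving-∈ʳ i z∈)) ∷ db

descending⇒unique : ∀ {xs} → Descending xs → Unique xs
descending⇒unique = AllPairs.map (λ x>y x≡y → <-irrefl (sym x≡y) x>y)

top : List ℕ → ℕ → ℕ
top []      f = f
top (y ∷ _) f = y

top∈ : ∀ ys {f xs} → top ys f ∈ ys ++ f ∷ xs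
top∈ []      = here refl
top∈ (_ ∷ _) = here refl

≤-top : ∀ ys {f xs z} → Descending (ys ++ f ∷ xs) → z ∈ ys ++ f ∷ xs → z ≤ top ys f
≤-top []      (f> ∷ _) (here refl) = ≤-refl
≤-top []      (f> ∷ _) (there z∈)  = <⇒≤ (All.lookup f> z∈)
≤-top (y ∷ _) (y> ∷ _) (here refl) = ≤-refl
≤-top (y ∷ _) (y> ∷ _) (there z∈)  = <⇒≤ (All.lookup y> z∈)

TreeFamily : Set
TreeFamily = List ℕ → ℕ → List ℕ → List LabeledTree

onFocus : TreeFamily → List ℕ × ℕ × List ℕ → List LabeledTree
onFocus T (as , u , bs) = T as u bs

rights : TreeFamily → ℕ → List ℕ → List LabeledTree
rights T m ws = concatMap (onFocus T) (filter (λ (_ , u , _) → u <? m) (foci ws))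

onSplits : TreeFamily → ℕ → ℕ → (List ℕ × List ℕ) × (List ℕ × List ℕ) → List LabeledTree
onSplits T y f ((ys₁ , ys₂) , (xs₁ , xs₂)) =
  cartesianProductWith (λ l r → node l y r) (T ys₁ f xs₁) (rights T (top ys₁ f) (ys₂ ++ xs₂))

branches : TreeFamily → ℕ → List ℕ → ℕ → List ℕ → List LabeledTree
branches T y ys f xs = concatMap (onSplits T y f) (cartesianProduct (splits ys) (splits xs))

-- The good trees with first label f and other labels ys (above f) and xs
-- (below f), both lists descending; the first argument is fuel.
treesFrom : ℕ → List ℕ → ℕ → List ℕ → List LabeledTree
treesFrom n       []       f []      = [ node (leaf tt) f (leaf tt) ]
treesFrom n       []       f (_ ∷ _) = []
treesFrom zero    (y ∷ ys) f xs      = []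
treesFrom (suc n) (y ∷ ys) f xs      = branches (treesFrom n) y ys f xs

trees : ℕ → List ℕ → List LabeledTree
trees n ws = concatMap (onFocus (treesFrom n)) (foci ws)

record Branch (T : TreeFamily) (f y : ℕ)
              (ys₁ ys₂ xs₁ xs₂ : List ℕ) (t : LabeledTree) : Set where
  constructor mkBranch
  field
    {l r}   : LabeledTree
    {as bs} : List ℕ
    {u}     : ℕ
    t≡      : t ≡ node l y r
    l∈      : l ∈ T ys₁ f xs₁
    r∈      : r ∈ T as u bs
    focus   : as ++ u ∷ bs ≡ ys₂ ++ xs₂
    u<      : u < top ys₁ f

∈-rights⁻ : ∀ T m ws {r} → r ∈ rights T m ws →
  ∃₂ λ as u → ∃ λ bs → r ∈ T as u bs × as ++ u ∷ bs ≡ ws × u < m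
∈-rights⁻ T m ws r∈
  with (as , u , bs) , s∈ , r∈s ← find (∈-concatMap⁻ (onFocus T) {xs = filter (λ (_ , u , _) → u <? m) (foci ws)} r∈)
  with s∈f , u<m ← ∈-filter⁻ (λ (_ , u , _) → u <? m) s∈
  = as , u , bs , r∈s , ∈-foci⁻ ws s∈f , u<m

∈-rights⁺ : ∀ T {m as u bs r} → r ∈ T as u bs → u < m → r ∈ rights T m (as ++ u ∷ bs)
∈-rights⁺ T {m} {as} r∈ u<m = ∈-concatMap⁺ (onFocus T)
  (lose (∈-filter⁺ (λ (_ , u , _) → u <? m) (∈-foci⁺ as) u<m) r∈)

∈-product⁻ : ∀ T {y ys₁ ys₂ f xs₁ xs₂ t} →
  t ∈ onSplits T y f ((ys₁ , ys₂) , (xs₁ , xs₂)) →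
  Branch T f y ys₁ ys₂ xs₁ xs₂ t
∈-product⁻ T {y} {ys₁} {ys₂} {f} {xs₁} {xs₂} t∈
  with l , r , l∈ , r∈ , refl ← ∈-cartesianProductWith⁻ (λ l r → node l y r) (T ys₁ f xs₁) _ t∈
  with as , u , bs , r∈T , focus , u< ← ∈-rights⁻ T (top ys₁ f) (ys₂ ++ xs₂) r∈
  = mkBranch refl l∈ r∈T focus u<

∈-branches⁻ : ∀ T y ys f xs {t} → t ∈ branches T y ys f xs →
  ∃₂ λ ys₁ ys₂ → ∃₂ λ xs₁ xs₂ →
    Interleaving ys₁ ys₂ ys × Interleaving xs₁ xs₂ xs × Branch T f y ys₁ ys₂ xs₁ xs₂ t
∈-branches⁻ T y ys f xs t∈
  with ((ys₁ , ys₂) , xs₁ , xs₂) , s∈ , t∈s ← find (∈-concatMap⁻ (onSplits T y f) {xs = cartesianProduct (splits ys) (splits xs)} t∈)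
  with ys∈ , xs∈ ← ∈-cartesianProduct⁻ (splits ys) (splits xs) s∈
  = ys₁ , ys₂ , xs₁ , xs₂ , ∈-splits⁻ ys ys∈ , ∈-splits⁻ xs xs∈ , ∈-product⁻ T t∈s

∈-branches⁺ : ∀ T {y ys f xs ys₁ ys₂ xs₁ xs₂ t} →
  Interleaving ys₁ ys₂ ys → Interleaving xs₁ xs₂ xs → Branch T f y ys₁ ys₂ xs₁ xs₂ t →
  t ∈ branches T y ys f xs
∈-branches⁺ T {y} {f = f} i j (mkBranch refl l∈ r∈ focus u<) = ∈-concatMap⁺ (onSplits T y f)
  (lose (∈-cartesianProduct⁺ (∈-splits⁺ i) (∈-splits⁺ j))
    (∈-cartesianProductWith⁺ (λ l r → node l _ r) l∈ (subst (λ ws → _ ∈ rights T _ ws) focus (∈-rights⁺ T r∈ u<))))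

postorder-↭ : ∀ l y r → postorder (node l y r) ↭ y ∷ (postorder l ++ postorder r)
postorder-↭ l y r = ↭-trans (↭-reflexive (trans (postorder-node l y r) (sym (++-assoc (postorder l) (postorder r) [ y ]))))
  (++-comm (postorder l ++ postorder r) [ y ])

record Sound (ys : List ℕ) (f : ℕ) (xs : List ℕ) (t : LabeledTree) : Set where
  constructor sound
  field
    good   : Good t
    first≡ : first t ≡ f
    root≡  : root t ≡ top ys f
    labels : postorder t ↭ ys ++ f ∷ xs

treesFrom-sound : ∀ n ys f xs → Descending (ys ++ f ∷ xs) → ∀ {t} → t ∈ treesFrom n ys f xs → Sound ys f xs t
treesFrom-sound n       []       f []  _ (here refl) = sound vertex refl refl ↭-refl
treesFrom-sound (suc n) (y ∷ ys) f xs (y> ∷ ws↓) t∈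
  with ys₁ , ys₂ , xs₁ , xs₂ , i , j , mkBranch {l} {r} {as} {bs} {u} refl l∈ r∈ focus u< ← ∈-branches⁻ (treesFrom n) y ys f xs t∈
  = sound (branch gl gr (subst₂ _<_ (sym fr) (sym rl) u<)
             (below (interleaving-∈ˡ k (∈-resp-↭ pl (good-root∈ gl))))
             (below (interleaving-∈ʳ k (subst (root r ∈_) focus (∈-resp-↭ pr (good-root∈ gr))))))
          (trans (first-branch gl) fl) refl
          (↭-trans (postorder-↭ l y r) (prep y (↭-trans (++⁺ pl (↭-trans pr (↭-reflexive focus))) (↭-sym (toPermutation k)))))
  where
  k : Interleaving (ys₁ ++ f ∷ xs₁) (ys₂ ++ xs₂) (ys ++ f ∷ xs)
  k = Interleaving.++⁺ i (consˡ j)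
  below : ∀ {z} → z ∈ ys ++ f ∷ xs → z < y
  below = All.lookup y>
  ih-l = treesFrom-sound n ys₁ f xs₁ (proj₁ (interleaving-descending k ws↓)) l∈
  ih-r = treesFrom-sound n as u bs (subst Descending (sym focus) (proj₂ (interleaving-descending k ws↓))) r∈
  open Sound ih-l renaming (good to gl; first≡ to fl; root≡ to rl; labels to pl)
  open Sound ih-r renaming (good to gr; first≡ to fr; labels to pr) using ()

≤-root : ∀ {t z} → Good t → z ∈ postorder t → z ≤ root t
≤-root {node l x r} g z∈ = s≤s⁻¹ (decreasing-below (good⇒decreasing g) (node ≤-refl) z∈)

root≡top : ∀ {t} ys {f xs} → Descending (ys ++ f ∷ xs) → Good t → postorder t ↭ ys ++ f ∷ xs → root t ≡ top ys f
root≡top ys ws↓ g p = ≤-antisym (≤-top ys ws↓ (∈-resp-↭ p (good-root∈ g)))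
  (≤-root g (∈-resp-↭ (↭-sym p) (top∈ ys)))

first<root : ∀ {l x r} → Good (node l x r) → Good l → first l < x
first<root (branch _ _ _ l<x _) gl = ≤-<-trans (≤-root gl (good-first∈ gl)) l<x

treesFrom-complete : ∀ n ys f xs → Descending (ys ++ f ∷ xs) → length ys + length xs ≤ n →
  ∀ {t} → Good t → first t ≡ f → postorder t ↭ ys ++ f ∷ xs → t ∈ treesFrom n ys f xs
treesFrom-complete n []       f []       _   _ vertex refl p = here refl
treesFrom-complete n []       f (x ∷ xs) _   _ vertex refl p with () ← ↭-length p
treesFrom-complete n (y ∷ ys) f xs       _   _ vertex refl p
  with () ← trans (↭-length p) (cong suc (trans (length-++ ys) (+-suc (length ys) (length xs))))
treesFrom-complete n []       f xs ws↓ _ g@(branch gl gr r<l l<x r<x) refl p =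
  contradiction (sym (root≡top [] ws↓ g p)) (<⇒≢ (subst (_< _) (sym (first-branch gl)) (first<root g gl)))
treesFrom-complete (suc n) (y ∷ ys) f xs ws↓@(_ ∷ ws↓′) (s≤s le) {node l x r} g@(branch gl gr r<l l<x r<x) first≡ p
  with refl ← root≡top (y ∷ ys) ws↓ g p
  with as , bs , i , pl , pr ← ↭-interleaving (postorder l) (postorder r) (ys ++ f ∷ xs)
         (drop-∷ (↭-trans (↭-sym (postorder-↭ l x r)) p))
  with ys₁ , ys₂ , xs₁ , xs₂ , refl , refl , j , k ← interleaving-focus⁻ ys i (λ f∈ →
         proj₂ (proj₂ (unique-node⁻ l x r (unique-resp-↭ (↭-sym p) (descending⇒unique ws↓))))
           ( subst (_∈ postorder l) (trans (sym (first-branch gl)) first≡) (good-first∈ gl)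
           , ∈-resp-↭ (↭-sym pr) f∈))
  with eas , ebs , focus ← ∈-∃++ (∈-resp-↭ pr (good-first∈ gr))
  = ∈-branches⁺ (treesFrom n) j k (mkBranch refl
      (treesFrom-complete n ys₁ f xs₁ l↓ (≤-trans (+-mono-≤ (shorterˡ j) (shorterˡ k)) le) gl (trans (sym (first-branch gl)) first≡) pl)
      (treesFrom-complete n eas (first r) ebs (subst Descending focus r↓) (≤-trans (<⇒≤ size) le) gr refl (↭-trans pr (↭-reflexive focus)))
      (sym focus)
      (subst (first r <_) (root≡top ys₁ l↓ gl pl) r<l))
  where
  l↓ = proj₁ (interleaving-descending i ws↓′)
  r↓ = proj₂ (interleaving-descending i ws↓′)
  shorterˡ : ∀ {as bs ws : List ℕ} → Interleaving as bs ws → length as ≤ length ws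
  shorterˡ {as} {bs} i = ≤-trans (m≤m+n (length as) (length bs)) (≤-reflexive (sym (Interleaving.interleave-length i)))
  shorterʳ : ∀ {as bs ws : List ℕ} → Interleaving as bs ws → length bs ≤ length ws
  shorterʳ {as} {bs} i = ≤-trans (m≤n+m (length bs) (length as)) (≤-reflexive (sym (Interleaving.interleave-length i)))
  size : length eas + length ebs < length ys + length xs
  size = subst (_≤ length ys + length xs)
    (trans (trans (sym (length-++ ys₂)) (cong length focus)) (trans (length-++ eas) (+-suc (length eas) (length ebs))))
    (+-mono-≤ (shorterʳ j) (shorterʳ k))

concatMap-onFocus-unique : ∀ n {ss} ws → Descending ws → Unique ss → (∀ {s} → s ∈ ss → s ∈ foci ws) →
  (∀ as u bs → Descending (as ++ u ∷ bs) → Unique (treesFrom n as u bs)) →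
  Unique (concatMap (onFocus (treesFrom n)) ss)
concatMap-onFocus-unique n ws ws↓ ss! ss⊆ each = unique-concatMap (onFocus (treesFrom n)) ss!
  (λ {(as , u , bs)} s∈ → each as u bs (piece (ss⊆ s∈))) key
  where
  piece : ∀ {as u bs} → (as , u , bs) ∈ foci ws → Descending (as ++ u ∷ bs)
  piece s∈ = subst Descending (sym (∈-foci⁻ ws s∈)) ws↓
  key : ∀ {s s′ t} → s ∈ _ → s′ ∈ _ → t ∈ onFocus (treesFrom n) s → t ∈ onFocus (treesFrom n) s′ → s ≡ s′
  key {as , u , bs} {as′ , u′ , bs′} s∈ s′∈ t∈ t∈′
    with refl ← trans (sym (Sound.first≡ (treesFrom-sound n as u bs (piece (ss⊆ s∈)) t∈)))
                      (Sound.first≡ (treesFrom-sound n as′ u′ bs′ (piece (ss⊆ s′∈)) t∈′))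
    = focus-injective (descending⇒unique (piece (ss⊆ s∈)))
        (trans (∈-foci⁻ ws (ss⊆ s∈)) (sym (∈-foci⁻ ws (ss⊆ s′∈))))

treesFrom-unique : ∀ n ys f xs → Descending (ys ++ f ∷ xs) → Unique (treesFrom n ys f xs)
treesFrom-unique n       []       f []      _ = [] ∷ []
treesFrom-unique n       []       f (_ ∷ _) _ = []
treesFrom-unique zero    (y ∷ ys) f xs      _ = []
treesFrom-unique (suc n) (y ∷ ys) f xs (_ ∷ ws↓) = unique-concatMap (onSplits (treesFrom n) y f)
  (Unique.cartesianProduct⁺ (unique-splits ys!) (unique-splits xs!)) each key
  where
  Splits = cartesianProduct (splits ys) (splits xs)
  ws! = descending⇒unique ws↓
  ys! = proj₁ (unique-++⁻ ys ws!)
  xs! = AllPairs.tail (proj₁ (proj₂ (unique-++⁻ ys ws!)))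
  merged : ∀ {ys₁ ys₂ xs₁ xs₂} → ((ys₁ , ys₂) , (xs₁ , xs₂)) ∈ Splits →
    Interleaving ys₁ ys₂ ys × Interleaving xs₁ xs₂ xs
  merged s∈ = let (a , b) = ∈-cartesianProduct⁻ (splits ys) (splits xs) s∈ in ∈-splits⁻ ys a , ∈-splits⁻ xs b
  pieces : ∀ {ys₁ ys₂ xs₁ xs₂} → ((ys₁ , ys₂) , (xs₁ , xs₂)) ∈ Splits →
    Descending (ys₁ ++ f ∷ xs₁) × Descending (ys₂ ++ xs₂)
  pieces s∈ = let (i , j) = merged s∈ in interleaving-descending (Interleaving.++⁺ i (consˡ j)) ws↓
  each : ∀ {s} → s ∈ Splits → Unique (onSplits (treesFrom n) y f s)
  each {(ys₁ , ys₂) , (xs₁ , xs₂)} s∈ =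
    let (l↓ , r↓) = pieces s∈
    in Unique.cartesianProductWith⁺ (λ l r → node l y r) (λ { refl → refl , refl }) (treesFrom-unique n ys₁ f xs₁ l↓)
         (concatMap-onFocus-unique n (ys₂ ++ xs₂) r↓
           (Unique.filter⁺ (λ (_ , u , _) → u <? top ys₁ f) (unique-foci (ys₂ ++ xs₂)))
           (λ s∈ → proj₁ (∈-filter⁻ (λ (_ , u , _) → u <? top ys₁ f) s∈))
           (treesFrom-unique n))
  labels : ∀ {ys₁ ys₂ xs₁ xs₂ l r} → ((ys₁ , ys₂) , (xs₁ , xs₂)) ∈ Splits →
    Branch (treesFrom n) f y ys₁ ys₂ xs₁ xs₂ (node l y r) →
    postorder l ↭ ys₁ ++ f ∷ xs₁ × postorder r ↭ ys₂ ++ xs₂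
  labels s∈ (mkBranch {as = as} {bs} {u} refl l∈ r∈ focus _) =
    let (l↓ , r↓) = pieces s∈
    in Sound.labels (treesFrom-sound n _ f _ l↓ l∈) ,
       ↭-trans (Sound.labels (treesFrom-sound n as u bs (subst Descending (sym focus) r↓) r∈)) (↭-reflexive focus)
  key : ∀ {s s′ t} → s ∈ Splits → s′ ∈ Splits →
    t ∈ onSplits (treesFrom n) y f s → t ∈ onSplits (treesFrom n) y f s′ → s ≡ s′
  key {(ys₁ , ys₂) , (xs₁ , xs₂)} {(ys₁′ , ys₂′) , (xs₁′ , xs₂′)} s∈ s′∈ t∈ t∈′
    with b@(mkBranch {l} {r} refl _ _ _ _) ← ∈-product⁻ (treesFrom n) {y} {ys₁} {ys₂} {f} {xs₁} {xs₂} t∈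
    with b′ ← ∈-product⁻ (treesFrom n) {y} {ys₁′} {ys₂′} {f} {xs₁′} {xs₂′} t∈′
    with pl , pr ← labels s∈ b
    with pl′ , pr′ ← labels s′∈ b′
    with i , j ← merged s∈
    with i′ , j′ ← merged s′∈
    = cong₂ _,_
        (interleaving-determined i i′
          (λ (z∈ , z∈′) → apart pl pr′ (∈-++⁺ˡ z∈ , ∈-++⁺ˡ z∈′))
          (λ (z∈ , z∈′) → apart pl′ pr (∈-++⁺ˡ z∈ , ∈-++⁺ˡ z∈′)))
        (interleaving-determined j j′
          (λ (z∈ , z∈′) → apart pl pr′ (∈-++⁺ʳ ys₁ (there z∈) , ∈-++⁺ʳ ys₂′ z∈′))
          (λ (z∈ , z∈′) → apart pl′ pr (∈-++⁺ʳ ys₁′ (there z∈) , ∈-++⁺ʳ ys₂ z∈′)))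
    where
    l#r : Disjoint (postorder l) (postorder r)
    l#r = proj₂ (proj₂ (unique-++⁻ (postorder l) (unique-resp-↭ (↭-sym (++⁺ pl pr))
            (unique-resp-↭ (toPermutation (Interleaving.++⁺ i (consˡ j))) ws!))))
    apart : ∀ {us vs} → postorder l ↭ us → postorder r ↭ vs → Disjoint us vs
    apart p q (z∈ , z∈′) = l#r (∈-resp-↭ (↭-sym p) z∈ , ∈-resp-↭ (↭-sym q) z∈′)

trees-unique : ∀ n ws → Descending ws → Unique (trees n ws)
trees-unique n ws ws↓ = concatMap-onFocus-unique n ws ws↓ (unique-foci ws) (λ s∈ → s∈) (treesFrom-unique n)

trees-sound : ∀ n ws → Descending ws → ∀ {t} → t ∈ trees n ws → Good t × postorder t ↭ ws
trees-sound n ws ws↓ t∈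
  with (as , u , bs) , s∈ , t∈s ← find (∈-concatMap⁻ (onFocus (treesFrom n)) {xs = foci ws} t∈)
  with refl ← ∈-foci⁻ ws s∈
  with sound g _ _ p ← treesFrom-sound n as u bs ws↓ t∈s = g , p

trees-complete : ∀ n ws → Descending ws → length ws ≤ suc n → ∀ {t} → Good t → postorder t ↭ ws → t ∈ trees n ws
trees-complete n ws ws↓ le {t} g p
  with as , bs , refl ← ∈-∃++ (∈-resp-↭ p (good-first∈ g))
  = ∈-concatMap⁺ (onFocus (treesFrom n)) (lose (∈-foci⁺ as)
      (treesFrom-complete n as (first t) bs ws↓
        (s≤s⁻¹ (≤-trans (≤-reflexive (sym (trans (length-++ as) (+-suc (length as) (length bs))))) le)) g refl p))

-- The length of the enumeration

sumOver : ∀ {A : Set} → (A → ℤ) → List A → ℤ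
sumOver h []       = 0ℤ
sumOver h (x ∷ xs) = h x ℤ.+ sumOver h xs

sumOver-cong : ∀ {A : Set} {g h : A → ℤ} xs → (∀ {x} → x ∈ xs → g x ≡ h x) → sumOver g xs ≡ sumOver h xs
sumOver-cong []       eq = refl
sumOver-cong (x ∷ xs) eq = cong₂ ℤ._+_ (eq (here refl)) (sumOver-cong xs (eq ∘ there))

sumOver-++ : ∀ {A : Set} (h : A → ℤ) xs ys → sumOver h (xs ++ ys) ≡ sumOver h xs ℤ.+ sumOver h ys
sumOver-++ h []       ys = sym (ℤ.+-identityˡ _)
sumOver-++ h (x ∷ xs) ys = trans (cong (λ z → h x ℤ.+ z) (sumOver-++ h xs ys)) (sym (ℤ.+-assoc (h x) _ _))

sumOver-map : ∀ {A B : Set} (h : B → ℤ) (f : A → B) xs → sumOver h (map f xs) ≡ sumOver (h ∘ f) xs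
sumOver-map h f []       = refl
sumOver-map h f (x ∷ xs) = cong (λ z → h (f x) ℤ.+ z) (sumOver-map h f xs)

sumOver-+ : ∀ {A : Set} (g h : A → ℤ) xs → sumOver (λ x → g x ℤ.+ h x) xs ≡ sumOver g xs ℤ.+ sumOver h xs
sumOver-+ g h []       = refl
sumOver-+ g h (x ∷ xs) = trans (cong (λ z → (g x ℤ.+ h x) ℤ.+ z) (sumOver-+ g h xs)) (+-interchange (g x) (h x) _ _)

sumOver-*ˡ : ∀ {A : Set} c (h : A → ℤ) xs → sumOver (λ x → c ℤ.* h x) xs ≡ c ℤ.* sumOver h xs
sumOver-*ˡ c h []       = sym (ℤ.*-zeroʳ c)
sumOver-*ˡ c h (x ∷ xs) = trans (cong (λ z → c ℤ.* h x ℤ.+ z) (sumOver-*ˡ c h xs)) (sym (ℤ.*-distribˡ-+ c (h x) _))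

sumOver-zero : ∀ {A : Set} {h : A → ℤ} xs → (∀ {x} → x ∈ xs → h x ≡ 0ℤ) → sumOver h xs ≡ 0ℤ
sumOver-zero []       eq = refl
sumOver-zero (x ∷ xs) eq = cong₂ ℤ._+_ (eq (here refl)) (sumOver-zero xs (eq ∘ there))

sumOver-cartesianProduct : ∀ {A B : Set} (h : A × B → ℤ) xs ys →
  sumOver h (cartesianProduct xs ys) ≡ sumOver (λ x → sumOver (λ y → h (x , y)) ys) xs
sumOver-cartesianProduct h []       ys = refl
sumOver-cartesianProduct h (x ∷ xs) ys = trans (sumOver-++ h (map (x ,_) ys) _)
  (cong₂ ℤ._+_ (sumOver-map h (x ,_) ys) (sumOver-cartesianProduct h xs ys))

length-concatMap : ∀ {A B : Set} (h : A → List B) xs → + length (concatMap h xs) ≡ sumOver (λ x → + length (h x)) xs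
length-concatMap h []       = refl
length-concatMap h (x ∷ xs) = trans (cong +_ (length-++ (h x)))
  (trans (ℤ.pos-+ (length (h x)) _) (cong (λ z → + length (h x) ℤ.+ z) (length-concatMap h xs)))

length-cartesianProductWith : ∀ {A B C : Set} (f : A → B → C) xs ys →
  length (cartesianProductWith f xs ys) ≡ length xs * length ys
length-cartesianProductWith f []       ys = refl
length-cartesianProductWith f (x ∷ xs) ys = trans (length-++ (map (f x) ys))
  (cong₂ _+_ (length-map (f x) ys) (length-cartesianProductWith f xs ys))

unless : ∀ {P : Set} → Dec P → ℤ → ℤ
unless (yes _) v = 0ℤ
unless (no  _) v = v

unless-yes : ∀ {P : Set} (d : Dec P) {v} → P → unless d v ≡ 0ℤ
unless-yes (yes _) p = refl
unless-yes (no ¬p) p = contradiction p ¬p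

unless-no : ∀ {P : Set} (d : Dec P) {v} → ¬ P → unless d v ≡ v
unless-no (yes p) ¬p = contradiction p ¬p
unless-no (no _)  ¬p = refl

sumOver-filter : ∀ {A : Set} {P : A → Set} (P? : Decidable P) (h : A → ℤ) xs →
  sumOver h (filter P? xs) ≡ sumOver h xs ℤ.- sumOver (λ x → unless (P? x) (h x)) xs
sumOver-filter P? h []       = refl
sumOver-filter P? h (x ∷ xs) with P? x
... | yes _ = trans (cong (λ z → h x ℤ.+ z) (sumOver-filter P? h xs)) (keep (h x) _ _)
  where
  keep : ∀ a b c → a ℤ.+ (b ℤ.- c) ≡ (a ℤ.+ b) ℤ.- (0ℤ ℤ.+ c)
  keep = solve-∀
... | no _  = trans (sumOver-filter P? h xs) (skip (h x) _ _)
  where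
  skip : ∀ a b c → b ℤ.- c ≡ (a ℤ.+ b) ℤ.- (a ℤ.+ c)
  skip = solve-∀

sumOver-splits : ∀ {A : Set} (F : ℕ → ℕ → ℤ) (xs : List A) →
  sumOver (λ s → F (length (proj₁ s)) (length (proj₂ s))) (splits xs) ≡ splitSum F (length xs)
sumOver-splits F []       = ℤ.+-identityʳ (F 0 0)
sumOver-splits F (x ∷ xs) = trans (sumOver-++ _ (map (map₁ (x ∷_)) (splits xs)) _)
  (cong₂ ℤ._+_ (trans (sumOver-map _ (map₁ (x ∷_)) (splits xs)) (sumOver-splits (λ a b → F (suc a) b) xs))
               (trans (sumOver-map _ (map₂ (x ∷_)) (splits xs)) (sumOver-splits (λ a b → F a (suc b)) xs)))

sumOver-foci : ∀ {A : Set} (F : ℕ → ℕ → ℤ) (xs : List A) →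
  sumOver (λ (as , _ , bs) → F (length as) (length bs)) (foci xs) ≡ focusSum F (length xs)
sumOver-foci F []       = refl
sumOver-foci F (x ∷ xs) = cong (λ z → F 0 (length xs) ℤ.+ z)
  (trans (sumOver-map _ (map₁ (x ∷_)) (foci xs)) (sumOver-foci (λ a b → F (suc a) b) xs))

badFoci : (ℕ → ℕ → ℤ) → ℕ → List ℕ → ℤ
badFoci F m ws = sumOver (λ (as , u , bs) → unless (u <? m) (F (length as) (length bs))) (foci ws)

badFoci-below : ∀ F m ws → (∀ {z} → z ∈ ws → z < m) → badFoci F m ws ≡ 0ℤ
badFoci-below F m ws below = sumOver-zero (foci ws) λ {(as , u , bs)} s∈ →
  unless-yes (u <? m) (below (subst (u ∈_) (∈-foci⁻ ws s∈) (∈-++⁺ʳ as (here refl))))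

-- Only an element of ys that lies above everything going to the left can be
-- focused, so all elements before it go to the right.
badFoci-sum : ∀ (W : ℕ → ℕ → ℕ → ℕ → ℤ) ys f xs → Descending (ys ++ f ∷ xs) →
  sumOver (λ (ys₁ , ys₂) → sumOver (λ (xs₁ , xs₂) →
    badFoci (W (length ys₁) (length xs₁)) (top ys₁ f) (ys₂ ++ xs₂)) (splits xs)) (splits ys)
  ≡ focusSum (λ α β → splitSum₂ (λ β₁ β₂ p₁ p₂ → W β₁ p₁ α (β₂ + p₂)) β (length xs)) (length ys)
badFoci-sum W []       f xs (f> ∷ _) = trans (ℤ.+-identityʳ _) (sumOver-zero (splits xs) λ {(xs₁ , xs₂)} s∈ →
  badFoci-below (W 0 (length xs₁)) f xs₂ (All.lookup f> ∘ interleaving-∈ʳ (∈-splits⁻ xs s∈)))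
badFoci-sum W (y ∷ ys) f xs (y> ∷ ws↓) = begin
  sumOver G (map (map₁ (y ∷_)) (splits ys) ++ map (map₂ (y ∷_)) (splits ys))
    ≡⟨ sumOver-++ G (map (map₁ (y ∷_)) (splits ys)) _ ⟩
  sumOver G (map (map₁ (y ∷_)) (splits ys)) ℤ.+ sumOver G (map (map₂ (y ∷_)) (splits ys))
    ≡⟨ cong₂ ℤ._+_ (trans (sumOver-map G (map₁ (y ∷_)) (splits ys)) left) (sumOver-map G (map₂ (y ∷_)) (splits ys)) ⟩
  0ℤ ℤ.+ sumOver (G ∘ map₂ (y ∷_)) (splits ys)
    ≡⟨ ℤ.+-identityˡ _ ⟩
  sumOver (G ∘ map₂ (y ∷_)) (splits ys)
    ≡⟨ sumOver-cong (splits ys) (λ {s} s∈ → trans (sumOver-cong (splits xs) (λ {t} t∈ → right s t s∈ t∈)) (sumOver-+ (first-is-y s) (later s) (splits xs))) ⟩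
  sumOver (λ s → sumOver (first-is-y s) (splits xs) ℤ.+ sumOver (later s) (splits xs)) (splits ys)
    ≡⟨ sumOver-+ _ _ (splits ys) ⟩
  sumOver (λ s → sumOver (first-is-y s) (splits xs)) (splits ys) ℤ.+
  sumOver (λ s → sumOver (later s) (splits xs)) (splits ys)
    ≡⟨ cong₂ ℤ._+_
         (trans (sumOver-cong (splits ys) (λ {s} _ → sumOver-splits (λ p₁ p₂ → W (length (proj₁ s)) p₁ 0 (length (proj₂ s) + p₂)) xs))
                (sumOver-splits (λ β₁ β₂ → splitSum (λ p₁ p₂ → W β₁ p₁ 0 (β₂ + p₂)) (length xs)) ys))
         (badFoci-sum (λ β₁ p₁ α b → W β₁ p₁ (suc α) b) ys f xs ws↓) ⟩
  splitSum₂ (λ β₁ β₂ p₁ p₂ → W β₁ p₁ 0 (β₂ + p₂)) (length ys) (length xs) ℤ.+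
  focusSum (λ α β → splitSum₂ (λ β₁ β₂ p₁ p₂ → W β₁ p₁ (suc α) (β₂ + p₂)) β (length xs)) (length ys) ∎
  where
  term : List ℕ × List ℕ → List ℕ × List ℕ → ℤ
  term (ys₁ , ys₂) (xs₁ , xs₂) = badFoci (W (length ys₁) (length xs₁)) (top ys₁ f) (ys₂ ++ xs₂)
  G : List ℕ × List ℕ → ℤ
  G s = sumOver (term s) (splits xs)
  first-is-y later : List ℕ × List ℕ → List ℕ × List ℕ → ℤ
  first-is-y (ys₁ , ys₂) (xs₁ , xs₂) = W (length ys₁) (length xs₁) 0 (length ys₂ + length xs₂)
  later (ys₁ , ys₂) (xs₁ , xs₂) = badFoci (λ a b → W (length ys₁) (length xs₁) (suc a) b) (top ys₁ f) (ys₂ ++ xs₂)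
  left : sumOver (G ∘ map₁ (y ∷_)) (splits ys) ≡ 0ℤ
  left = sumOver-zero (splits ys) λ {(ys₁ , ys₂)} s∈ → sumOver-zero (splits xs) λ {(xs₁ , xs₂)} t∈ →
    badFoci-below (W (suc (length ys₁)) (length xs₁)) y (ys₂ ++ xs₂)
      (All.lookup y> ∘ interleaving-∈ʳ (Interleaving.++⁺ (∈-splits⁻ ys s∈) (consˡ (∈-splits⁻ xs t∈))))
  right : ∀ s t → s ∈ splits ys → t ∈ splits xs → term (map₂ (y ∷_) s) t ≡ first-is-y s t ℤ.+ later s t
  right (ys₁ , ys₂) (xs₁ , xs₂) s∈ t∈ = cong₂ ℤ._+_
    (trans (unless-no (y <? top ys₁ f) (<-asym (All.lookup y> top∈ys)))
           (cong (W (length ys₁) (length xs₁) 0) (length-++ ys₂)))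
    (sumOver-map _ (map₁ (y ∷_)) (foci (ys₂ ++ xs₂)))
    where
    top∈ys : top ys₁ f ∈ ys ++ f ∷ xs
    top∈ys = interleaving-∈ˡ (Interleaving.++⁺ (∈-splits⁻ ys s∈) (consˡ (∈-splits⁻ xs t∈))) (top∈ ys₁)

badFoci-*ˡ : ∀ c F m ws → badFoci (λ a b → c ℤ.* F a b) m ws ≡ c ℤ.* badFoci F m ws
badFoci-*ˡ c F m ws = trans (sumOver-cong (foci ws) (λ {(as , u , bs)} _ → unless-* (u <? m) (F (length as) (length bs))))
  (sumOver-*ˡ c _ (foci ws))
  where
  unless-* : ∀ {P : Set} (d : Dec P) v → unless d (c ℤ.* v) ≡ c ℤ.* unless d v
  unless-* (yes _) v = sym (ℤ.*-zeroʳ c)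
  unless-* (no _)  v = refl

length-treesFrom : ∀ n ys f xs → Descending (ys ++ f ∷ xs) →
  + length (treesFrom n ys f xs) ≡ countFrom n (length ys) (length xs)
length-treesFrom n       []       f []      _ = refl
length-treesFrom n       []       f (_ ∷ _) _ = refl
length-treesFrom zero    (y ∷ ys) f xs      _ = refl
length-treesFrom (suc n) (y ∷ ys) f xs (_ ∷ ws↓) = begin
  + length (branches (treesFrom n) y ys f xs)
    ≡⟨ length-concatMap (onSplits (treesFrom n) y f) Splits ⟩
  sumOver (λ s → + length (onSplits (treesFrom n) y f s)) Splits
    ≡⟨ sumOver-cong Splits (λ {s} → length-onSplits s) ⟩
  sumOver (λ s → all s ℤ.+ -1ℤ ℤ.* bad s) Splits
    ≡⟨ trans (sumOver-+ all (λ s → -1ℤ ℤ.* bad s) Splits)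
         (cong (λ z → sumOver all Splits ℤ.+ z) (trans (sumOver-*ˡ -1ℤ bad Splits) (ℤ.-1*i≡-i (sumOver bad Splits)))) ⟩
  sumOver all Splits ℤ.- sumOver bad Splits
    ≡⟨ cong₂ ℤ._-_
         (trans (sumOver-cartesianProduct all (splits ys) (splits xs))
           (trans (sumOver-cong (splits ys) (λ {(ys₁ , ys₂)} _ →
               sumOver-splits (λ p₁ p₂ → c (length ys₁) p₁ ℤ.* focusSum c (length ys₂ + p₂)) xs))
             (sumOver-splits (λ q₁ q₂ → splitSum (λ p₁ p₂ → c q₁ p₁ ℤ.* focusSum c (q₂ + p₂)) (length xs)) ys)))
         (trans (sumOver-cartesianProduct bad (splits ys) (splits xs))
           (badFoci-sum (λ b p a m → c b p ℤ.* c a m) ys f xs ws↓)) ⟩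
  allPairs c (length ys) (length xs) ℤ.- badPairs c (length ys) (length xs) ∎
  where
  c = countFrom n
  Splits = cartesianProduct (splits ys) (splits xs)
  all bad : (List ℕ × List ℕ) × (List ℕ × List ℕ) → ℤ
  all ((ys₁ , ys₂) , (xs₁ , xs₂)) = c (length ys₁) (length xs₁) ℤ.* focusSum c (length ys₂ + length xs₂)
  bad ((ys₁ , ys₂) , (xs₁ , xs₂)) =
    badFoci (λ a b → c (length ys₁) (length xs₁) ℤ.* c a b) (top ys₁ f) (ys₂ ++ xs₂)
  length-rights : ∀ m ws → Descending ws →
    + length (rights (treesFrom n) m ws) ≡ focusSum c (length ws) ℤ.- badFoci c m ws
  length-rights m ws ws↓ = begin
    + length (rights (treesFrom n) m ws)
      ≡⟨ length-concatMap (onFocus (treesFrom n)) kept ⟩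
    sumOver (λ s → + length (onFocus (treesFrom n) s)) kept
      ≡⟨ sumOver-cong kept (λ {(as , u , bs)} s∈ → length-treesFrom n as u bs
           (subst Descending (sym (∈-foci⁻ ws (proj₁ (∈-filter⁻ below? s∈)))) ws↓)) ⟩
    sumOver (λ (as , _ , bs) → c (length as) (length bs)) kept
      ≡⟨ sumOver-filter below? (λ (as , _ , bs) → c (length as) (length bs)) (foci ws) ⟩
    sumOver (λ (as , _ , bs) → c (length as) (length bs)) (foci ws) ℤ.- badFoci c m ws
      ≡⟨ cong (λ z → z ℤ.- badFoci c m ws) (sumOver-foci c ws) ⟩
    focusSum c (length ws) ℤ.- badFoci c m ws ∎
    where
    below? : Decidable (λ (s : List ℕ × ℕ × List ℕ) → proj₁ (proj₂ s) < m)
    below? (_ , u , _) = u <? m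
    kept = filter below? (foci ws)
  length-onSplits : ∀ s → s ∈ Splits → + length (onSplits (treesFrom n) y f s) ≡ all s ℤ.+ -1ℤ ℤ.* bad s
  length-onSplits s@((ys₁ , ys₂) , (xs₁ , xs₂)) s∈ = begin
    + length (onSplits (treesFrom n) y f s)
      ≡⟨ cong +_ (length-cartesianProductWith (λ l r → node l y r) L R) ⟩
    + (length L * length R)
      ≡⟨ ℤ.pos-* (length L) (length R) ⟩
    + length L ℤ.* + length R
      ≡⟨ cong₂ ℤ._*_ (length-treesFrom n ys₁ f xs₁ l↓)
           (trans (length-rights (top ys₁ f) (ys₂ ++ xs₂) r↓)
             (cong (λ k → focusSum c k ℤ.- B) (length-++ ys₂))) ⟩
    cL ℤ.* (focusSum c (length ys₂ + length xs₂) ℤ.- B)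
      ≡⟨ distrib cL _ B ⟩
    all s ℤ.+ -1ℤ ℤ.* (cL ℤ.* B)
      ≡⟨ cong (λ z → all s ℤ.+ -1ℤ ℤ.* z) (badFoci-*ˡ cL c (top ys₁ f) (ys₂ ++ xs₂)) ⟨
    all s ℤ.+ -1ℤ ℤ.* bad s ∎
    where
    L  = treesFrom n ys₁ f xs₁
    R  = rights (treesFrom n) (top ys₁ f) (ys₂ ++ xs₂)
    B  = badFoci c (top ys₁ f) (ys₂ ++ xs₂)
    cL = c (length ys₁) (length xs₁)
    distrib : ∀ x y z → x ℤ.* (y ℤ.- z) ≡ x ℤ.* y ℤ.+ -1ℤ ℤ.* (x ℤ.* z)
    distrib = solve-∀
    pieces : Descending (ys₁ ++ f ∷ xs₁) × Descending (ys₂ ++ xs₂)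
    pieces = let (a , b) = ∈-cartesianProduct⁻ (splits ys) (splits xs) s∈ in
      interleaving-descending (Interleaving.++⁺ (∈-splits⁻ ys a) (consˡ (∈-splits⁻ xs b))) ws↓
    l↓ = proj₁ pieces
    r↓ = proj₂ pieces

length-trees : ∀ n ws → Descending ws → length ws ≤ suc n → + length (trees n ws) ≡ total (length ws)
length-trees n ws ws↓ le = begin
  + length (trees n ws)
    ≡⟨ length-concatMap (onFocus (treesFrom n)) (foci ws) ⟩
  sumOver (λ s → + length (onFocus (treesFrom n) s)) (foci ws)
    ≡⟨ sumOver-cong (foci ws) (λ {(as , u , bs)} s∈ →
         length-treesFrom n as u bs (subst Descending (sym (∈-foci⁻ ws s∈)) ws↓)) ⟩
  sumOver (λ (as , _ , bs) → countFrom n (length as) (length bs)) (foci ws)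
    ≡⟨ sumOver-foci (countFrom n) ws ⟩
  focusSum (countFrom n) (length ws)
    ≡⟨ focusSum-cong (length ws) (λ a b e → count-fuel n a b (s≤s⁻¹ (≤-trans (≤-reflexive e) le))) ⟩
  total (length ws) ∎

descendingTo1 : ℕ → List ℕ
descendingTo1 = applyDownFrom suc

descendingTo1-descending : ∀ n → Descending (descendingTo1 n)
descendingTo1-descending n = AllPairs.applyDownFrom⁺₁ suc n (λ j<i _ → s≤s j<i)

∈-descendingTo1 : ∀ n {x} → x ∈ descendingTo1 n ⇔ (1 ≤ x × x ≤ n)
∈-descendingTo1 n = mk⇔ to from
  where
  to : ∀ {x} → x ∈ descendingTo1 n → 1 ≤ x × x ≤ n
  to x∈ with _ , i<n , refl ← ∈-applyDownFrom⁻ suc x∈ = s≤s z≤n , i<n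
  from : ∀ {x} → 1 ≤ x × x ≤ n → x ∈ descendingTo1 n
  from (s≤s z≤n , x≤n) = ∈-applyDownFrom⁺ suc x≤n

lonely⇒good : ∀ {t} → IsNormalizedLonely t → Good t
lonely⇒good {leaf _} nl with () ← IsDecreasingBinaryPlaneTree.nonEmpty (IsNormalizedLonely.isDecreasingBinaryPlaneTree nl)
lonely⇒good {node l x r} nl = determined⇒good decreasing distinct (lonely⇒determined isDecreasingBinaryPlaneTree lonely)
  where
  open IsNormalizedLonely nl
  open IsDecreasingBinaryPlaneTree isDecreasingBinaryPlaneTree

normalized⇒↭ : ∀ {t} → IsNormalizedLonely t → postorder t ↭ descendingTo1 (#nodes t)
normalized⇒↭ {t} nl = subst (λ m → postorder t ↭ descendingTo1 m) (sym n≡) p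
  where
  open IsNormalizedLonely nl
  n = proj₁ normalized
  p : postorder t ↭ descendingTo1 n
  p = ∼bag⇒↭ (unique∧set⇒bag (IsDecreasingBinaryPlaneTree.distinct isDecreasingBinaryPlaneTree)
    (descending⇒unique (descendingTo1-descending n))
    (λ {x} → mk⇔ (λ x∈ → Equivalence.from (∈-descendingTo1 n) (Equivalence.to (proj₂ normalized x) x∈))
                 (λ x∈ → Equivalence.from (proj₂ normalized x) (Equivalence.to (∈-descendingTo1 n) x∈))))
  n≡ : #nodes t ≡ n
  n≡ = trans (sym (length-postorder t)) (trans (↭-length p) (length-applyDownFrom suc n))

good⇒normalizedLonely : ∀ {t n} → Good t → postorder t ↭ descendingTo1 n → IsNormalizedLonely t
good⇒normalizedLonely {t} {n} g p = record
  { isDecreasingBinaryPlaneTree = record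
    { nonEmpty   = subst (0 <_) (sym (good-#nodes g)) (s≤s z≤n)
    ; positive   = All.tabulate (λ x∈ → proj₁ (Equivalence.to (∈-descendingTo1 n) (∈-resp-↭ p x∈)))
    ; distinct   = unique-resp-↭ (↭-sym p) (descending⇒unique (descendingTo1-descending n))
    ; decreasing = good⇒decreasing g }
  ; normalized = n , λ x → mk⇔ (λ x∈ → Equivalence.to (∈-descendingTo1 n) (∈-resp-↭ p x∈))
                               (λ b → ∈-resp-↭ (↭-sym p) (Equivalence.from (∈-descendingTo1 n) b))
  ; lonely     = good⇒lonely g }

2∤1+d+d : ∀ d → ¬ (2 ∣ suc (d + d))
2∤1+d+d d 2∣ = contradiction (∣1⇒≡1 (∣m+n∣m⇒∣n (subst (2 ∣_) (+-comm 1 (d + d)) 2∣) (divides d (d+d≡d*2 d)))) λ ()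
  where
  d+d≡d*2 : ∀ d → d + d ≡ d * 2
  d+d≡d*2 = ℕ.solve-∀

good-odd : ∀ {t} → Good t → ¬ (2 ∣ #nodes t)
good-odd {t} g 2∣ = 2∤1+d+d (descents t) (subst (2 ∣_) (good-#nodes g) 2∣)

trees-cardinality : ∀ n → HasCardinality (λ t → IsNormalizedLonely t × #nodes t ≡ n)
  (length (trees n (descendingTo1 n)))
trees-cardinality n = trees n ws , trees-unique n ws ws↓ , (λ t → mk⇔ to from) , refl
  where
  ws = descendingTo1 n
  ws↓ = descendingTo1-descending n
  to : ∀ {t} → t ∈ trees n ws → IsNormalizedLonely t × #nodes t ≡ n
  to {t} t∈ with g , p ← trees-sound n ws ws↓ t∈ = good⇒normalizedLonely g p ,
    trans (sym (length-postorder t)) (trans (↭-length p) (length-applyDownFrom suc n))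
  from : ∀ {t} → IsNormalizedLonely t × #nodes t ≡ n → t ∈ trees n ws
  from (nl , refl) = trees-complete n ws ws↓ (≤-trans (≤-reflexive (length-applyDownFrom suc n)) (n≤1+n n))
    (lonely⇒good nl) (normalized⇒↭ nl)

length-trees-odd : ∀ k → let n = 2 * k + 1 in + length (trees n (descendingTo1 n)) ≡ lassalle (k + 1)
length-trees-odd k = begin
  + length (trees n (descendingTo1 n)) ≡⟨ length-trees n (descendingTo1 n) (descendingTo1-descending n)
                                            (≤-trans (≤-reflexive (length-applyDownFrom suc n)) (n≤1+n n)) ⟩
  total (length (descendingTo1 n))     ≡⟨ cong total (trans (length-applyDownFrom suc n)
                                            (trans (+-comm (2 * k) 1) (cong suc (sym (double≡2* k))))) ⟩
  total (suc (double k))               ≡⟨ total≡lassalle k k ≤-refl ⟩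
  lassalle (suc k)                     ≡⟨ cong lassalle (+-comm 1 k) ⟩
  lassalle (k + 1)                     ∎
  where
  n = 2 * k + 1

mainTheorem3 : (∀ (t : LabeledTree) → IsNormalizedLonely t → ¬ (2 ∣ #nodes t))
    × (∀ (k : ℕ) → ∃[ N ] (+ N ≡ lassalle (k + 1)
    × HasCardinality (λ t → IsNormalizedLonely t × #nodes t ≡ 2 * k + 1) N))
mainTheorem3 = (λ t nl → good-odd (lonely⇒good nl)) ,
  λ k → length (trees (2 * k + 1) (descendingTo1 (2 * k + 1))) , length-trees-odd k , trees-cardinality (2 * k + 1)
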